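{- Let $k\in\mathbb{N}$. Suppose that $T$ is a strongly $(k^2+3k)$-connected tournament and that $x_1,\dots,x_k,y_1,\dots,y_k$ are vertices of $T$ such that $x_i\neq y_i$ for all $i\in[k]$ and the ordered pairs $(x_1,y_1),\dots,(x_k,y_k)$ are pairwise distinct. Then $T$ contains pairwise internally disjoint directed paths $P_1,\dots,P_k$, where $P_i$ goes from $x_i$ to $y_i$, such that $\{x_1,\dots,x_k,y_1,\dots,y_k\}\cap V(P_i)=\{x_i,y_i\}$ for each $i\in[k]$ and $V(T)=\bigcup_{i=1}^k V(P_i)$.
   Context: A digraph $G$ is strongly $k$-connected if $|G|>k$ and for every set $F\subseteq V(G)$ with $|F|<k$ and every ordered pair $x,y$ of vertices of $V(G)\setminus F$ there is a directed path from $x$ to $y$ in $G-F$. $[k]=\{1,\dots,k\}$. -}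

module Defs where

open import Data.Fin.Base using (Fin)
open import Data.Fin.Subset using (Subset; ∣_∣) renaming (_∉_ to _∉ₛ_)
open import Data.List.Base using (List; head; last)
open import Data.List.Membership.Propositional using (_∈_)
open import Data.List.Relation.Unary.Linked using (Linked)
open import Data.List.Relation.Unary.Unique.Propositional using (Unique)
open import Data.Maybe.Base using (just)
open import Data.Nat.Base using (ℕ; _<_)
open import Data.Product.Base using (_×_; Σ-syntax)
open import Data.Sum.Base using (_⊎_)
open import Level using (0ℓ)
open import Relation.Binary.Core using (Rel)
open import Relation.Binary.Definitions using (Irreflexive; Asymmetric)
open import Relation.Binary.PropositionalEquality using (_≡_; _≢_)
open import Relation.Unary using (Pred; _⊆_; ∁; ｛_｝; _∪_; _∩_; ⋃)

-- Finite, loopless, without parallel edges; both x ⟶ y and y ⟶ x may hold.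
record Digraph : Set₁ where
  infix 4 _⟶_
  field
    order    : ℕ
    _⟶_      : Rel (Fin order) 0ℓ
    loopless : Irreflexive _≡_ _⟶_

  Vertex : Set
  Vertex = Fin order

-- The two fields carry enough data to decide _⟶_.
record IsTournament (G : Digraph) : Set where
  open Digraph G
  field
    adjacent : ∀ {x y} → x ≢ y → x ⟶ y ⊎ y ⟶ x
    asym     : Asymmetric _⟶_

module _ (G : Digraph) where
  open Digraph G

  -- The one-vertex path is allowed when x ≡ y.
  record DirectedPath (x y : Vertex) : Set where
    field
      vertices : List Vertex
      starts   : head vertices ≡ just x
      ends     : last vertices ≡ just y
      linked   : Linked _⟶_ vertices
      distinct : Unique vertices

module _ {G : Digraph} where
  open Digraph G

  V : ∀ {x y} → DirectedPath G x y → Pred Vertex 0ℓ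
  V P = _∈ DirectedPath.vertices P

  Interior : ∀ {x y} → DirectedPath G x y → Pred Vertex 0ℓ
  Interior {x} {y} P = V P ∩ ∁ (｛ x ｝ ∪ ｛ y ｝)

  -- No inner vertex of either path lies on the other path.
  InternallyDisjoint : ∀ {x y x′ y′} →
                       DirectedPath G x y → DirectedPath G x′ y′ → Set
  InternallyDisjoint P Q = (Interior P ⊆ ∁ (V Q)) × (Interior Q ⊆ ∁ (V P))

-- A path of G - F is a path of G all of whose vertices lie outside F.
StronglyConnected : ℕ → Digraph → Set
StronglyConnected k G =
  (k < order) ×
  ((F : Subset order) → ∣ F ∣ < k →
   (x y : Vertex) → x ∉ₛ F → y ∉ₛ F →
   Σ[ P ∈ DirectedPath G x y ] V P ⊆ (_∉ₛ F))
  where open Digraph G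

-- {x₁ , … , xₖ , y₁ , … , yₖ}
Terminals : ∀ {k} {A : Set} → (x y : Fin k → A) → Pred A 0ℓ
Terminals {k} x y = ⋃ (Fin k) λ i → ｛ x i ｝ ∪ ｛ y i ｝

{-# OPTIONS --safe #-}
module Submission where

-- Delete all terminals and let Oⱼ, Iⱼ be the sets of out-neighbours of xⱼ and in-neighbours of yⱼ.  It
-- suffices to split the remaining vertices into paths running from Oⱼ to Iⱼ.  Connectivity says that
-- every Oⱼ still reaches everything, and every Iⱼ is still reached from everything, after fewer than
-- h = n² + n + 1 further deletions; call such sets h-good.  Pairs are removed one at a time.
--
-- If some Oⱼ contains a vertex u that is at distance more than two from O₀, then u dominates O₀: reserve
-- u as the first vertex of the j-th path and replace Oⱼ by O₀ (similarly for Iⱼ).  If there is no such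
-- vertex, remove a shortest path from O₀ to I₀.  The first vertices of that path, and four consecutive
-- vertices of it, suffice as a replacement for the whole path in the connectivity conditions, because
-- the path has no shortcuts and all Oⱼ lie near O₀; hence goodness drops by at most four.
--
-- If all Oⱼ have become equal to O₀ (or all Iⱼ to I₀), Menger's theorem gives three disjoint paths of each
-- type.  Insert vertices into these paths as long as possible.  The vertices left over then see only the
-- two ends of every path, and form a tournament with a Hamiltonian path or cycle which can be attached by
-- joining at most three paths, so that each type keeps at least one.  Finally, two disjoint paths of the
-- same type in a tournament always merge into one.

open import Defs
open import Data.Fin.Base using (Fin)
open import Data.Nat.Base using (ℕ; _+_; _*_; _^_; _≥_)
open import Data.Product.Base using (_×_; _,_; Σ-syntax)
open import Function.Definitions using (Injective)
open import Relation.Binary.PropositionalEquality using (_≡_; _≢_)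
open import Relation.Unary using (｛_｝; _∪_; _∩_; _≐_; U; ⋃)

open import Data.Empty using (⊥; ⊥-elim)
open import Data.Fin.Base using (zero; suc; remQuot; combine)
open import Data.Fin.Patterns using (0F; 1F; 2F; 3F; 4F; 5F)
open import Data.Fin.Properties using (_≟_; any?; remQuot-combine; combine-injectiveʳ)
open import Data.Fin.Subset using (Subset; inside; outside; ∣_∣; ⁅_⁆)
  renaming (⊥ to ∅; _∪_ to _∪ₛ_; _∈_ to _∈ₛ_)
open import Data.Fin.Subset.Properties
  using (∣⊥∣≡0; ∣⁅x⁆∣≡1; x∈p∪q⁻; x∈⁅y⁆⇒x≡y; ∉⊥; p⊆p∪q; q⊆p∪q; x∈⁅x⁆)
open import Data.List.Base
  using (List; []; _∷_; _++_; map; concatMap; foldr; length; filter; take; reverse; tabulate;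
         deduplicate; cartesianProduct; allFin; head; last; initLast; _∷ʳ′_)
open import Data.List.Membership.Propositional using (_∈_; _∉_; find; lose)
open import Data.List.Membership.Propositional.Properties
  using (∈-++⁺ˡ; ∈-++⁺ʳ; ∈-++⁻; ∈-∃++; ∈-map⁺; ∈-map⁻; ∈-filter⁺; ∈-filter⁻; ∈-deduplicate⁺;
         ∈-deduplicate⁻; ∈-cartesianProduct⁺; ∈-cartesianProduct⁻; ∈-allFin; ∈-tabulate⁺; ∈-tabulate⁻)
open import Data.List.Properties
  using (++-assoc; ++-identityʳ; ∷-injective; concatMap-++; filter-notAll; length-++; length-filter;
         length-map; length-reverse; length-tabulate; length-take; map-++; map-∘; unfold-reverse)
open import Data.List.Relation.Binary.Permutation.Propositional
  using (_↭_; prep; swap; ↭-refl; ↭-sym; ↭-trans; ↭-reflexive; ↭⇒↭ₛ)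
open import Data.List.Relation.Binary.Permutation.Propositional.Properties
  using (∈-resp-↭; ↭-length; ↭-map-inv; ↭-reverse; map⁺; filter-↭; shift; shifts; ∷↭∷ʳ;
         ++⁺; ++⁺ˡ; ++⁺ʳ; ++-comm; ++-commutativeMonoid)
import Data.List.Relation.Binary.Permutation.Setoid.Properties as SetoidPerm
open import Data.List.Relation.Binary.Subset.Propositional using (_⊆_)
open import Data.List.Relation.Unary.All as All using (All; []; _∷_; lookup; all?)
open import Data.List.Relation.Unary.All.Properties using (¬All⇒Any¬)
open import Data.List.Relation.Unary.AllPairs using ([]; _∷_)
open import Data.List.Relation.Unary.Any as Any using (here; there)
import Data.List.Relation.Unary.Any.Properties as AnyP
open import Data.List.Relation.Unary.Linked using (Linked; [-]; _∷_)
open import Data.List.Relation.Unary.Unique.Propositional using (Unique)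
import Data.List.Relation.Unary.Unique.DecPropositional.Properties as DecUniqueₚ
import Data.List.Relation.Unary.Unique.Propositional.Properties as Uniqueₚ
open import Data.Maybe.Base using (just)
open import Data.Nat.Base using (zero; suc; pred; _≤_; _<_; z≤n; s≤s)
open import Data.Nat.Properties
  using (≤-refl; ≤-reflexive; ≤-trans; ≤-pred; <-≤-trans; ≤-<-trans; n≮n; n≤1+n; m≤n⇒m≤1+n;
         m≤m+n; m≤n+m; m≤n⇒m⊓n≡m; m⊓n≤m; m<1+n⇒m<n∨m≡n; ≮⇒≥; ≰⇒>; _≤?_; +-comm; +-identityʳ;
         +-suc; +-mono-≤; +-monoˡ-≤; +-monoʳ-≤; +-monoˡ-<; +-monoʳ-<; +-cancelˡ-≤; +-cancelʳ-≤)
open import Data.Nat.Tactic.RingSolver using (solve-∀)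
open import Data.Product.Base using (∃; ∃₂; proj₁; proj₂)
open import Data.Sum.Base using (_⊎_; inj₁; inj₂)
open import Data.Sum.Properties using (≡-dec; inj₂-injective)
import Data.Vec.Base as Vec
import Data.Vec.Functional as VF
open import Data.Vec.Functional.Properties using (updateAt-updates; updateAt-minimal)
open import Function.Base using (_∘_; const; flip; id)
open import Relation.Binary.Definitions using (DecidableEquality)
open import Relation.Binary.PropositionalEquality using (refl; sym; trans; cong; cong₂; subst; setoid)
open import Relation.Nullary using (¬_; Dec; yes; no)
open import Relation.Nullary.Decidable using (¬?; _×-dec_; _⊎-dec_)
open import Relation.Unary using (Decidable)

-- Where the numbers come from: with m + 1 pairs left, there are 2m sets besides `O₀` and `I₀`, each
-- replaced at most once, and a path is removed only while both sides still have an index on their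
-- list. So at most 2m - 2 reservations precede a removal. Each costs one unit of goodness and the
-- removal costs four, so `bound (m + 1)` is `bound m` plus 2m + 2. The start is `bound 1`, which is
-- 3, the number of disjoint paths needed for a single pair; this sums to n² + n + 1. The 2k
-- terminals add 2k - 1, because the terminal from which connectivity is applied is not itself
-- deleted.
--
-- Equal start sets help because the type of a path then depends on its last vertex alone: any path
-- followed by one of type j is again of type j, so leftover vertices can be attached by
-- concatenating paths of different types. If both the start sets and the end sets differ, such a
-- concatenation need not serve any pair.

private variable
  A : Set

-- Lists

Unique-↭ : {xs ys : List A} → xs ↭ ys → Unique xs → Unique ys
Unique-↭ {A} e = SetoidPerm.Unique-resp-↭ (setoid A) (↭⇒↭ₛ e)

Unique-++ : (xs : List A) {ys : List A} → Unique (xs ++ ys) →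
            Unique xs × Unique ys × (∀ {v} → v ∈ xs → v ∉ ys)
Unique-++ []       u        = [] , u , λ ()
Unique-++ (x ∷ xs) {ys} (n ∷ u) with Unique-++ xs u
... | ux , uy , d = (left xs n ∷ ux) , uy ,
    λ { (here refl) q → lookup n (∈-++⁺ʳ xs q) refl ; (there p) q → d p q }
  where
  left : ∀ {P : A → Set} xs {ys} → All P (xs ++ ys) → All P xs
  left []       _        = []
  left (x ∷ xs) (p ∷ ps) = p ∷ left xs ps

-- Lists serve as finite sets here, and cardinality arguments rest on this remainder `zs`: counting
-- it gives `Unique⇒length≤`, and its emptiness gives `Unique⇒↭`.
complement : {xs ys : List A} → Unique xs → xs ⊆ ys → ∃ λ zs → xs ++ zs ↭ ys
complement {xs = []}     _       _ = _ , ↭-refl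
complement {xs = x ∷ xs} (n ∷ u) s with ∈-∃++ (s (here refl))
... | ys₁ , ys₂ , refl with complement u sub
  where
  sub : xs ⊆ ys₁ ++ ys₂
  sub {v} v∈ with ∈-++⁻ ys₁ (s (there v∈))
  ... | inj₁ p           = ∈-++⁺ˡ p
  ... | inj₂ (here refl) = ⊥-elim (lookup n v∈ refl)
  ... | inj₂ (there p)   = ∈-++⁺ʳ ys₁ p
... | zs , e = zs , ↭-trans (prep x e) (↭-sym (shift x ys₁ ys₂))

Unique⇒length≤ : {xs ys : List A} → Unique xs → xs ⊆ ys → length xs ≤ length ys
Unique⇒length≤ {xs = xs} u s with complement u s
... | zs , e = ≤-trans (m≤m+n _ _) (≤-reflexive (trans (sym (length-++ xs)) (↭-length e)))

Unique⇒↭ : {xs ys : List A} → Unique xs → xs ⊆ ys → length ys ≤ length xs → xs ↭ ys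
Unique⇒↭ {xs = xs} u s l with complement u s
... | []     , e = ↭-trans (↭-reflexive (sym (++-identityʳ xs))) e
... | z ∷ zs , e = ⊥-elim (absurd (≤-trans (≤-reflexive (trans (sym (length-++ xs)) (↭-length e))) l))
  where
  absurd : ¬ (length xs + suc (length zs) ≤ length xs)
  absurd q with +-cancelˡ-≤ (length xs) (suc (length zs)) 0
                  (≤-trans q (≤-reflexive (sym (+-identityʳ _))))
  ... | ()

take-⊆ : (k : ℕ) (xs : List A) → take k xs ⊆ xs
take-⊆ (suc k) (x ∷ xs) (here eq) = here eq
take-⊆ (suc k) (x ∷ xs) (there i) = there (take-⊆ k xs i)

∈⇒↭ : {x : A} {xs : List A} → x ∈ xs → ∃ λ ys → xs ↭ x ∷ ys
∈⇒↭ p with ∈-∃++ p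
... | ys , zs , refl = _ , shift _ ys zs

concatMap-↭ : {B : Set} (f : A → List B) {xs ys : List A} → xs ↭ ys → concatMap f xs ↭ concatMap f ys
concatMap-↭ f _↭_.refl         = ↭-refl
concatMap-↭ f (prep x e)       = ++⁺ˡ (f x) (concatMap-↭ f e)
concatMap-↭ f (swap x y e)     = ↭-trans (++⁺ˡ (f x) (++⁺ˡ (f y) (concatMap-↭ f e))) (shifts (f x) (f y))
concatMap-↭ f (_↭_.trans e e′) = ↭-trans (concatMap-↭ f e) (concatMap-↭ f e′)

concatMap-∈⁻ : {B : Set} (f : A → List B) (xs : List A) {v : B} → v ∈ concatMap f xs → ∃ λ x → x ∈ xs × v ∈ f x
concatMap-∈⁻ f (x ∷ xs) i with ∈-++⁻ (f x) i
... | inj₁ j = x , here refl , j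
... | inj₂ j with concatMap-∈⁻ f xs j
... | y , y∈ , k = y , there y∈ , k

concatMap-∈⁺ : {B : Set} (f : A → List B) {xs : List A} {v : B} {x : A} → x ∈ xs → v ∈ f x → v ∈ concatMap f xs
concatMap-∈⁺ f          (here refl) j = ∈-++⁺ˡ j
concatMap-∈⁺ f {y ∷ xs} (there i)   j = ∈-++⁺ʳ (f y) (concatMap-∈⁺ f i j)

++-interchange : (a b c d : List A) → (a ++ b) ++ c ++ d ↭ (a ++ c) ++ b ++ d
++-interchange {A} a b c d = prove 4 ((x ⊕ y) ⊕ (z ⊕ w)) ((x ⊕ z) ⊕ (y ⊕ w)) (a Vec.∷ b Vec.∷ c Vec.∷ d Vec.∷ Vec.[])
  where
  open import Algebra.Solver.CommutativeMonoid (++-commutativeMonoid {A = A})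
  x = var 0F ; y = var 1F ; z = var 2F ; w = var 3F

-- Walks

infixr 5 _▸_

-- The vertex list is an index, so that disjointness and covering become statements about `Unique`
-- and `↭` of concatenated lists. Vertices may repeat; simplicity is recorded separately.
data Walk {A : Set} (R : A → A → Set) : A → A → List A → Set where
  stop : ∀ x → Walk R x x (x ∷ [])
  _▸_  : ∀ {x y z p} → R x y → Walk R y z p → Walk R x z (x ∷ p)

module _ {R : A → A → Set} where

  walk-head : ∀ {x y p} → Walk R x y p → ∃ λ t → p ≡ x ∷ t
  walk-head (stop x) = _ , refl
  walk-head (_ ▸ _)  = _ , refl

  walk-last : ∀ {x y p} → Walk R x y p → ∃ λ t → p ≡ t ++ y ∷ []
  walk-last (stop x) = [] , refl
  walk-last (_ ▸ w) with walk-last w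
  ... | t , refl = _ ∷ t , refl

  head∈ : ∀ {x y p} → Walk R x y p → x ∈ p
  head∈ (stop x) = here refl
  head∈ (_ ▸ _)  = here refl

  last∈ : ∀ {x y p} → Walk R x y p → y ∈ p
  last∈ (stop x) = here refl
  last∈ (_ ▸ w)  = there (last∈ w)

  walk-++ : ∀ {x y z w p q} → Walk R x y p → R y z → Walk R z w q → Walk R x w (p ++ q)
  walk-++ (stop x) r v = r ▸ v
  walk-++ (e ▸ u)  r v = e ▸ walk-++ u r v

  walk-join : ∀ {x y z p q} → Walk R x y p → Walk R y z (y ∷ q) → Walk R x z (p ++ q)
  walk-join (stop x) v = v
  walk-join (e ▸ u)  v = e ▸ walk-join u v

  walk-suffix : ∀ p {x z u q} → Walk R x z (p ++ u ∷ q) → Walk R u z (u ∷ q)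
  walk-suffix []           (stop x) = stop x
  walk-suffix []           (e ▸ w)  = e ▸ w
  walk-suffix (_ ∷ [])     (_ ▸ w)  = walk-suffix [] w
  walk-suffix (_ ∷ y ∷ p)  (_ ▸ w)  = walk-suffix (y ∷ p) w

  walk-prefix : ∀ p {x z u q} → Walk R x z (p ++ u ∷ q) → Walk R x u (p ++ u ∷ [])
  walk-prefix []           (stop x) = stop x
  walk-prefix []           (e ▸ w)  = stop _
  walk-prefix (_ ∷ [])     (e ▸ w)  with walk-prefix [] w
  ... | stop _ with walk-head w
  ... | _ , refl = e ▸ stop _
  walk-prefix (_ ∷ y ∷ p)  (e ▸ w)  = e ▸ walk-prefix (y ∷ p) w

  walk-cut : ∀ {x z} u p v q → Walk R x z ((u ∷ p) ++ v ∷ q) →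
             ∃ λ y → Walk R x y (u ∷ p) × R y v × Walk R v z (v ∷ q)
  walk-cut u []      v q (e ▸ w) with walk-head w
  ... | _ , refl = _ , stop _ , e , w
  walk-cut u (y ∷ p) v q (e ▸ w) with walk-cut y p v q w
  ... | _ , w₁ , r , w₂ with walk-head w
  ... | _ , refl = _ , e ▸ w₁ , r , w₂

  module _ (_≟_ : DecidableEquality A) where

    open import Data.List.Membership.DecPropositional _≟_ using (_∈?_)

    walk-simple : ∀ {x y p} → Walk R x y p → ∃ λ q → Walk R x y q × Unique q × q ⊆ p
    walk-simple (stop x) = _ , stop x , [] ∷ [] , id
    walk-simple {x} (e ▸ w) with walk-simple w
    ... | q , w′ , u , s with x ∈? q
    ... | no x∉ = x ∷ q , e ▸ w′ , fresh q x∉ ∷ u , λ { (here eq) → here eq ; (there i) → there (s i) }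
      where
      fresh : ∀ q → x ∉ q → All (x ≢_) q
      fresh []      _ = []
      fresh (y ∷ q) n = (λ eq → n (here eq)) ∷ fresh q (n ∘ there)
    ... | yes x∈ with ∈-∃++ x∈
    ... | q₁ , q₂ , refl =
      x ∷ q₂ , walk-suffix q₁ w′ , proj₁ (proj₂ (Unique-++ q₁ u)) , there ∘ s ∘ ∈-++⁺ʳ q₁

  crossing : ∀ {P : A → Set} → Decidable P → ∀ {x y p} → Walk R x y p → P x → ¬ P y →
             ∃₂ λ u v → u ∈ p × v ∈ p × R u v × P u × ¬ P v
  crossing P? (stop x) px ¬px = ⊥-elim (¬px px)
  crossing P? {x} (_▸_ {y = y} e w) px ¬pz with P? y
  ... | no ¬py = x , y , here refl , there (head∈ w) , e , px , ¬py
  ... | yes py with crossing P? w py ¬pz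
  ... | u , v , u∈ , v∈ , r , pu , ¬pv = u , v , there u∈ , there v∈ , r , pu , ¬pv

walk-map : {R R′ : A → A → Set} → (∀ {x y} → R x y → R′ x y) → ∀ {x y p} → Walk R x y p → Walk R′ x y p
walk-map f (stop x) = stop x
walk-map f (e ▸ w)  = f e ▸ walk-map f w

walk-reverse : {R : A → A → Set} → ∀ {x y p} → Walk R x y p → Walk (flip R) y x (reverse p)
walk-reverse         (stop x) = stop x
walk-reverse {R = R} (_▸_ {x = x} {p = p} e w) =
  subst (Walk (flip R) _ x) (sym (unfold-reverse x p)) (walk-++ (walk-reverse w) e (stop x))

walk-unsnoc : {R : A → A → Set} → ∀ l {x y z} → Walk R x y (l ++ z ∷ []) →
              z ≡ y × (l ≡ [] ⊎ ∃ λ u → Walk R x u l × R u y)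
walk-unsnoc []          (stop _) = refl , inj₁ refl
walk-unsnoc []          (_ ▸ ())
walk-unsnoc (_ ∷ [])    (e ▸ w) with walk-unsnoc [] w | w
... | eq , _ | stop _ = eq , inj₂ (_ , stop _ , e)
... | _      | (_ ▸ ())
walk-unsnoc (_ ∷ b ∷ l) (e ▸ w) with walk-unsnoc (b ∷ l) w
... | eq , inj₂ (u , w′ , r) = eq , inj₂ (u , e ▸ w′ , r)

unique-owner : {B : Set} (f : A → List B) {xs : List A} → Unique (concatMap f xs) →
               ∀ {x y v} → x ∈ xs → y ∈ xs → v ∈ f x → v ∈ f y → x ≡ y
unique-owner f {z ∷ xs} u = go
  where
  d = Unique-++ (f z) u
  go : ∀ {x y v} → x ∈ z ∷ xs → y ∈ z ∷ xs → v ∈ f x → v ∈ f y → x ≡ y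
  go (here refl) (here refl) _ _ = refl
  go (here refl) (there j)   p q = ⊥-elim (proj₂ (proj₂ d) p (concatMap-∈⁺ f j q))
  go (there i)   (here refl) p q = ⊥-elim (proj₂ (proj₂ d) q (concatMap-∈⁺ f i p))
  go (there i)   (there j)   p q = unique-owner f (proj₁ (proj₂ d)) i j p q

filter-split : {P : A → Set} (P? : Decidable P) (xs : List A) →
               filter P? xs ++ filter (λ x → ¬? (P? x)) xs ↭ xs
filter-split P? []       = ↭-refl
filter-split P? (x ∷ xs) with P? x
... | yes _ = prep x (filter-split P? xs)
... | no  _ = ↭-trans (shift x (filter P? xs) _) (prep x (filter-split P? xs))

module _ {A : Set} {R : A → A → Set} {P : A → Set} (P? : Decidable P) where

  -- Keeps what follows the last vertex outside `P`; that vertex, if there is one, is the `u`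
  -- returned.
  walk-entering : ∀ {x y p} → Walk R x y p → P y →
    ∃₂ λ z q → Walk R z y q × (∀ {v} → v ∈ q → P v) × (z ≡ x ⊎ ∃ λ u → u ∈ p × ¬ P u × R u z)
  walk-entering (stop x) px = x , _ , stop x , (λ { (here refl) → px }) , inj₁ refl
  walk-entering {x} (e ▸ w) py with walk-entering w py
  ... | z , q , wq , al , inj₂ (u , u∈ , ¬pu , r) = z , q , wq , al , inj₂ (u , there u∈ , ¬pu , r)
  ... | z , q , wq , al , inj₁ refl with P? x
  ...   | yes px = x , _ , e ▸ wq , (λ { (here refl) → px ; (there i) → al i }) , inj₁ refl
  ...   | no ¬px = z , q , wq , al , inj₂ (x , here refl , ¬px , e)

  walk-leaving : ∀ {x y p} → Walk R x y p → P x →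
    ∃₂ λ z q → Walk R x z q × (∀ {v} → v ∈ q → P v) × (z ≡ y ⊎ ∃ λ u → u ∈ p × ¬ P u × R z u)
  walk-leaving (stop x) px = x , _ , stop x , (λ { (here refl) → px }) , inj₁ refl
  walk-leaving {x} (_▸_ {y = y} e w) px with P? y
  ... | no ¬py = x , _ , stop x , (λ { (here refl) → px }) , inj₂ (y , there (head∈ w) , ¬py , e)
  ... | yes py with walk-leaving w py
  ...   | z , q , wq , al , inj₁ eq = z , _ , e ▸ wq , (λ { (here refl) → px ; (there i) → al i }) , inj₁ eq
  ...   | z , q , wq , al , inj₂ (u , u∈ , ¬pu , r) =
    z , _ , e ▸ wq , (λ { (here refl) → px ; (there i) → al i }) , inj₂ (u , there u∈ , ¬pu , r)

-- Menger's theorem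

module _ {A : Set} (_≟_ : DecidableEquality A) where
  open import Data.List.Membership.DecPropositional _≟_ using (_∈?_)

  Arc : List (A × A) → A → A → Set
  Arc Es u v = (u , v) ∈ Es

  record Link (Es : List (A × A)) (As Bs : List A) : Set where
    constructor link
    field
      {src tgt} : A
      {vs}      : List A
      walk      : Walk (Arc Es) src tgt vs
      src∈      : src ∈ As
      tgt∈      : tgt ∈ Bs
  open Link

  -- Uniqueness of this list says at once that every link is simple and that the links are pairwise
  -- disjoint.
  nodes : ∀ {Es As Bs} → List (Link Es As Bs) → List A
  nodes = concatMap vs

  weaken : ∀ {e Es As Bs} → Link Es As Bs → Link (e ∷ Es) As Bs
  weaken (link w s t) = link (walk-map there w) s t

  inits tails : ∀ {Es As Bs} → List (Link Es As Bs) → List A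
  inits = concatMap (proj₁ ∘ walk-last ∘ walk)
  tails = concatMap (proj₁ ∘ walk-head ∘ walk)

  nodes↭tails : ∀ {Es As Bs} (ps : List (Link Es As Bs)) → nodes ps ↭ map src ps ++ tails ps
  nodes↭tails []       = ↭-refl
  nodes↭tails (p ∷ ps) with vs p | walk-head (walk p)
  ... | _ | t , refl = prep _ (↭-trans (++⁺ˡ t (nodes↭tails ps)) (shifts t (map src ps)))

  nodes↭inits : ∀ {Es As Bs} (ps : List (Link Es As Bs)) → nodes ps ↭ inits ps ++ map tgt ps
  nodes↭inits []       = ↭-refl
  nodes↭inits (p ∷ ps) with vs p | walk-last (walk p)
  ... | _ | t , refl = ↭-trans (++⁺ˡ (t ++ _) (nodes↭inits ps)) (++-interchange t (tgt p ∷ []) (inits ps) (map tgt ps))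

  -- The vertex at which two links meet must be counted once, hence `tails qs` in place of
  -- `nodes qs`.
  joins : ∀ {e Es As Bs Cs Ds} (ps : List (Link Es As Bs)) (qs : List (Link Es Cs Ds)) →
          map tgt ps ≡ map src qs →
          Σ[ rs ∈ List (Link (e ∷ Es) As Ds) ] length rs ≡ length ps × nodes rs ↭ nodes ps ++ tails qs
  joins []       []       _  = [] , refl , ↭-refl
  joins (p ∷ ps) (q ∷ qs) eq with joins ps qs (proj₂ (∷-injective eq)) | ∷-injective eq
  ... | rs , l , e | tgt≡ , _ with vs q | walk q | walk-head (walk q)
  ... | _ | wk | t , refl =
    link (walk-join (walk-map there (walk p)) (subst (λ z → Walk _ z _ (z ∷ t)) (sym tgt≡) (walk-map there wk)))
         (src∈ p) (tgt∈ q) ∷ rs ,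
    cong suc l ,
    ↭-trans (++⁺ˡ (vs p ++ t) e) (++-interchange (vs p) t (nodes ps) (tails qs))

  Separates : List (A × A) → List A → List A → List A → Set
  Separates Es As Bs S = (l : Link Es As Bs) → ∃ λ s → s ∈ S × s ∈ vs l

  -- Göring's step: links up to x ∷ S and links from y ∷ S, where S separates without the arc (x , y).
  module Recombine {x y Es As Bs S}
    (sep : Separates Es As Bs S)
    (ps : List (Link Es As (x ∷ S))) (qs : List (Link Es (y ∷ S) Bs))
    (pu : Unique (nodes ps)) (qu : Unique (nodes qs))
    (pe : map tgt ps ≡ x ∷ S) (qe : map src qs ≡ y ∷ S) where

    private
      pU = Unique-++ (inits ps) (Unique-↭ (nodes↭inits ps) pu)
      qU = Unique-++ (map src qs) (Unique-↭ (nodes↭tails qs) qu)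
      xS : Unique (x ∷ S)
      xS = subst Unique pe (proj₁ (proj₂ pU))
      yS : Unique (y ∷ S)
      yS = subst Unique qe (proj₁ qU)

      inits∌ : ∀ {s} → s ∈ inits ps → s ∉ S
      inits∌ i j = proj₂ (proj₂ pU) i (subst (_ ∈_) (sym pe) (there j))

      tails∌ : ∀ {s} → s ∈ tails qs → s ∉ S
      tails∌ i j = proj₂ (proj₂ qU) (subst (_ ∈_) (sym qe) (there j)) i

    -- The ends of the links already exhaust `S` and no vertex occurs twice, so vertices of `S`
    -- appear only as last vertices and an initial piece ending outside `S` avoids `S`.
    upto : ∀ {p w} → p ∈ ps → w ∈ vs p →
           w ∈ S ⊎ ∃ λ r → Walk (Arc Es) (src p) w r × (∀ {s} → s ∈ r → s ∉ S)
    upto {p} {w} p∈ w∈₀ with vs p | walk p | walk-last (walk p) |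
        (λ {s} → concatMap-∈⁺ (proj₁ ∘ walk-last ∘ walk) {v = s} p∈) | w∈₀
    ... | _ | wk | i , refl | sub | w∈ with ∈-++⁻ i w∈
    ... | inj₁ w∈i with ∈-∃++ w∈i
    ... | a , b , refl =
      inj₂ (a ++ w ∷ [] , walk-prefix a (subst (Walk _ _ _) (++-assoc a (w ∷ b) _) wk) , λ s∈ → inits∌ (sub (inc s∈)))
      where
      inc : ∀ {s} → s ∈ a ++ w ∷ [] → s ∈ a ++ w ∷ b
      inc s∈ with ∈-++⁻ a s∈
      ... | inj₁ j           = ∈-++⁺ˡ j
      ... | inj₂ (here refl) = ∈-++⁺ʳ a (here refl)
    upto {p} {w} p∈ w∈₀ | _ | wk | i , refl | sub | w∈ | inj₂ (here refl) with tgt∈ p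
    ... | there w∈S = inj₁ w∈S
    ... | here refl = inj₂ (_ , wk , avoid)
      where
      avoid : ∀ {s} → s ∈ i ++ w ∷ [] → s ∉ S
      avoid s∈ with ∈-++⁻ i s∈
      ... | inj₁ j           = inits∌ (sub j)
      ... | inj₂ (here refl) = Uniqueₚ.Unique[x∷xs]⇒x∉xs xS

    from : ∀ {q w} → q ∈ qs → w ∈ vs q →
           w ∈ S ⊎ ∃ λ r → Walk (Arc Es) w (tgt q) (w ∷ r) × (∀ {s} → s ∈ w ∷ r → s ∉ S)
    from {q} {w} q∈ w∈₀ with vs q | walk q | walk-head (walk q) |
        (λ {s} → concatMap-∈⁺ (proj₁ ∘ walk-head ∘ walk) {v = s} q∈) | w∈₀
    from {q} {w} q∈ _ | _ | wk | t , refl | sub | there w∈ with ∈-∃++ w∈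
    ... | a , b , refl = inj₂ (b , walk-suffix (src q ∷ a) wk , λ s∈ → tails∌ (sub (∈-++⁺ʳ a s∈)))
    from {q} {w} q∈ _ | _ | wk | t , refl | sub | here refl with src∈ q
    ... | there w∈S = inj₁ w∈S
    ... | here refl = inj₂ (_ , wk , λ { (here refl) → Uniqueₚ.Unique[x∷xs]⇒x∉xs yS ; (there j) → tails∌ (sub j) })

    -- At a common vertex outside `S`, an initial piece and a final piece would splice into a link
    -- without the new arc that avoids `S`, against `sep`.
    meet : ∀ {w} → w ∈ nodes ps → w ∈ nodes qs → w ∈ S
    meet w∈p w∈q with concatMap-∈⁻ vs ps w∈p | concatMap-∈⁻ vs qs w∈q
    ... | p , p∈ , i | q , q∈ , j with upto p∈ i | from q∈ j
    ... | inj₁ k | _      = k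
    ... | inj₂ _ | inj₁ k = k
    ... | inj₂ (r , wr , ar) | inj₂ (t , wt , at) with sep (link (walk-join wr wt) (src∈ p) (tgt∈ q))
    ... | s , s∈S , s∈ with ∈-++⁻ r s∈
    ... | inj₁ k = ⊥-elim (ar k s∈S)
    ... | inj₂ k = ⊥-elim (at (there k) s∈S)

  recombine : ∀ {x y Es As Bs S} → Separates Es As Bs S →
    (ps : List (Link Es As (x ∷ S))) (qs : List (Link Es (y ∷ S) Bs)) →
    Unique (nodes ps) → Unique (nodes qs) → map tgt ps ≡ x ∷ S → map src qs ≡ y ∷ S →
    Σ[ rs ∈ List (Link ((x , y) ∷ Es) As Bs) ] length rs ≡ length ps × Unique (nodes rs)
  recombine {x} {y} {Es} {As} {Bs} {S} sep (p ∷ ps) (q ∷ qs) pu qu pe qe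
    with joins {e = x , y} ps qs (trans (proj₂ (∷-injective pe)) (sym (proj₂ (∷-injective qe))))
  ... | rs , l , e = r ∷ rs , cong suc l , Unique-↭ (↭-sym perm) (Uniqueₚ.++⁺ pu L₂u disj)
    where
    open Recombine sep (p ∷ ps) (q ∷ qs) pu qu pe qe
    r : Link ((x , y) ∷ Es) As Bs
    r = link (walk-++ (walk-map there (walk p))
               (here (cong₂ _,_ (proj₁ (∷-injective pe)) (proj₁ (∷-injective qe))))
               (walk-map there (walk q)))
             (src∈ p) (tgt∈ q)
    L₂ = vs q ++ tails qs
    perm : nodes (r ∷ rs) ↭ nodes (p ∷ ps) ++ L₂
    perm = ↭-trans (++⁺ˡ (vs p ++ vs q) e) (++-interchange (vs p) (vs q) (nodes ps) (tails qs))
    qperm : nodes (q ∷ qs) ↭ S ++ L₂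
    qperm = ↭-trans (++⁺ˡ (vs q) (nodes↭tails qs))
              (subst (λ s → vs q ++ map src qs ++ tails qs ↭ s ++ L₂) (proj₂ (∷-injective qe))
                  (shifts (vs q) (map src qs)))
    L₂U = Unique-++ S (Unique-↭ qperm qu)
    L₂u = proj₁ (proj₂ L₂U)
    disj : ∀ {w} → ¬ (w ∈ nodes (p ∷ ps) × w ∈ L₂)
    disj (i , j) = proj₂ (proj₂ L₂U) (meet i (∈-resp-↭ (↭-sym qperm) (∈-++⁺ʳ S j))) j

  prefixTo : ∀ {x y Es u v p} S → Walk (Arc ((x , y) ∷ Es)) u v p →
             (∃₂ λ w q → Walk (Arc Es) u w q × w ∈ x ∷ S × q ⊆ p) ⊎ Walk (Arc Es) u v p
  prefixTo {x} S (stop u) = inj₂ (stop u)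
  prefixTo {x} {u = u} S (e ▸ w) with u ∈? (x ∷ S)
  ... | yes u∈ = inj₁ (_ , _ , stop u , u∈ , λ { (here refl) → here refl })
  prefixTo S (here refl ▸ w) | no u∉ = ⊥-elim (u∉ (here refl))
  prefixTo S (there e ▸ w)   | no u∉ with prefixTo S w
  ... | inj₁ (t , q , wq , t∈ , s) = inj₁ (t , _ , e ▸ wq , t∈ , λ { (here eq) → here eq ; (there i) → there (s i) })
  ... | inj₂ w′ = inj₂ (e ▸ w′)

  suffixFrom : ∀ {x y Es u v p} S → Walk (Arc ((x , y) ∷ Es)) u v p →
               (∃₂ λ w q → Walk (Arc Es) w v q × w ∈ y ∷ S × q ⊆ p) ⊎ Walk (Arc Es) u v p
  suffixFrom S (stop u) = inj₂ (stop u)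
  suffixFrom S (e ▸ w) with suffixFrom S w
  ... | inj₁ (t , q , wq , t∈ , s) = inj₁ (t , q , wq , t∈ , there ∘ s)
  suffixFrom S (here refl ▸ w) | inj₂ w′ = inj₁ (_ , _ , w′ , here refl , there)
  suffixFrom S (there e ▸ w)   | inj₂ w′ = inj₂ (e ▸ w′)

  -- Distinct values inside `z ∷ zs`, at least as many as its length, must exhaust it. The
  -- reordering lets two families of links be matched position by position.
  aligned : ∀ {B : Set} (f : B → A) {xs : List B} {z zs} → Unique (map f xs) → (∀ {x} → x ∈ xs → f x ∈ z ∷ zs) →
            length zs < length xs → ∃ λ ys → xs ↭ ys × map f ys ≡ z ∷ zs
  aligned f {xs} {z} {zs} u s l with ↭-map-inv f (Unique⇒↭ u sub (≤-trans l (≤-reflexive (sym (length-map f xs)))))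
    where
    sub : map f xs ⊆ z ∷ zs
    sub i with ∈-map⁻ f i
    ... | x , x∈ , refl = s x∈
  ... | ys , eq , e = ys , e , sym eq

  -- Göring's induction on the arcs. Let `S` be a small separator before the arc `(x , y)` is added.
  -- A small separator of `As` from `x ∷ S`, or of `y ∷ S` from `Bs`, still separates `As` from `Bs`
  -- afterwards: a walk using the arc passes `x` and `y`, and any other walk meets `S`. If neither
  -- exists, both sides have `k` links and these recombine.
  menger : ∀ Es As Bs k →
    (Σ[ ps ∈ List (Link Es As Bs) ] length ps ≡ k × Unique (nodes ps)) ⊎
    (∃ λ S → length S < k × Separates Es As Bs S)
  menger [] As Bs k with k ≤? length D
    where D = filter (_∈? Bs) (deduplicate _≟_ As)
  ... | yes k≤ = inj₁ (proj₁ (go D′ D′⊆) , trans (proj₁ (proj₂ (go D′ D′⊆))) (trans (length-take k D) (m≤n⇒m⊓n≡m k≤)) ,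
                       subst Unique (sym (proj₂ (proj₂ (go D′ D′⊆)))) (Uniqueₚ.take⁺ k Du))
    where
    D  = filter (_∈? Bs) (deduplicate _≟_ As)
    Du : Unique D
    Du = Uniqueₚ.filter⁺ (_∈? Bs) (DecUniqueₚ.deduplicate-! _≟_ As)
    D′ = take k D
    D′⊆ : ∀ {d} → d ∈ D′ → d ∈ As × d ∈ Bs
    D′⊆ i with ∈-filter⁻ (_∈? Bs) {xs = deduplicate _≟_ As} (take-⊆ k D i)
    ... | i′ , j = ∈-deduplicate⁻ _≟_ As i′ , j
    go : ∀ ds → (∀ {d} → d ∈ ds → d ∈ As × d ∈ Bs) →
         Σ[ ps ∈ List (Link [] As Bs) ] length ps ≡ length ds × nodes ps ≡ ds
    go []       _ = [] , refl , refl
    go (d ∷ ds) h with go ds (h ∘ there)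
    ... | ps , l , e = link (stop d) (proj₁ (h (here refl))) (proj₂ (h (here refl))) ∷ ps , cong suc l , cong (d ∷_) e
  ... | no k≰ = inj₂ (_ , ≰⇒> k≰ , sep)
    where
    sep : Separates [] As Bs (filter (_∈? Bs) (deduplicate _≟_ As))
    sep (link (stop d) s t) = d , ∈-filter⁺ (_∈? Bs) (∈-deduplicate⁺ _≟_ s) t , here refl
  menger ((x , y) ∷ Es) As Bs k with menger Es As Bs k
  ... | inj₁ (ps , l , u) = inj₁ (map weaken ps , trans (length-map weaken ps) l , subst Unique (eq ps) u)
    where
    eq : ∀ ps → nodes ps ≡ nodes (map weaken ps)
    eq []       = refl
    eq (p ∷ ps) = cong (vs p ++_) (eq ps)
  ... | inj₂ (S , S<k , sep) with menger Es As (x ∷ S) k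
  ... | inj₂ (S₁ , l₁ , sep₁) = inj₂ (S₁ , l₁ , sep′)
    where
    sep′ : Separates ((x , y) ∷ Es) As Bs S₁
    sep′ (link w s t) with prefixTo S w
    ... | inj₁ (_ , q , wq , t∈ , sub) with sep₁ (link wq s t∈)
    ...   | z , z∈ , z∈q = z , z∈ , sub z∈q
    sep′ (link w s t) | inj₂ w′ with sep (link w′ s t)
    ...   | z , z∈S , z∈p with ∈-∃++ z∈p
    ...   | a , b , refl with sep₁ (link (walk-prefix a w′) s (there z∈S))
    ...   | z′ , z′∈ , z′∈a with ∈-++⁻ a z′∈a
    ...   | inj₁ i           = z′ , z′∈ , ∈-++⁺ˡ i
    ...   | inj₂ (here refl) = z′ , z′∈ , ∈-++⁺ʳ a (here refl)
  menger ((x , y) ∷ Es) As Bs k | inj₂ (S , S<k , sep) | inj₁ (ps , pl , pu) with menger Es (y ∷ S) Bs k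
  ... | inj₂ (S₂ , l₂ , sep₂) = inj₂ (S₂ , l₂ , sep′)
    where
    sep′ : Separates ((x , y) ∷ Es) As Bs S₂
    sep′ (link w s t) with suffixFrom S w
    ... | inj₁ (_ , q , wq , s∈ , sub) with sep₂ (link wq s∈ t)
    ...   | z , z∈ , z∈q = z , z∈ , sub z∈q
    sep′ (link w s t) | inj₂ w′ with sep (link w′ s t)
    ...   | z , z∈S , z∈p with ∈-∃++ z∈p
    ...   | a , b , refl with sep₂ (link (walk-suffix a w′) (there z∈S) t)
    ...   | z′ , z′∈ , z′∈b = z′ , z′∈ , ∈-++⁺ʳ a z′∈b
  ... | inj₁ (qs , ql , qu)
    with aligned tgt {ps} (proj₁ (proj₂ (Unique-++ (inits ps) (Unique-↭ (nodes↭inits ps) pu)))) (λ {p} _ → tgt∈ p)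
           (≤-trans S<k (≤-reflexive (sym pl)))
       | aligned src {qs} (proj₁ (Unique-++ (map src qs) (Unique-↭ (nodes↭tails qs) qu))) (λ {q} _ → src∈ q)
           (≤-trans S<k (≤-reflexive (sym ql)))
  ... | ps′ , pp , pe | qs′ , qp , qe
    with recombine sep ps′ qs′ (Unique-↭ (concatMap-↭ vs pp) pu) (Unique-↭ (concatMap-↭ vs qp) qu) pe qe
  ... | rs , l , u = inj₁ (rs , trans l (trans (sym (↭-length pp)) pl) , u)

-- Linkages

-- `some` is a field of its own because `reach` is vacuous when `S ++ X` contains every vertex.
record Good {N} (E : Fin N → Fin N → Set) (h : ℕ) (X : List (Fin N)) (O : Fin N → Set) : Set where
  field
    some  : ∀ S → length S < h → ∃ λ o → O o × o ∉ S ++ X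
    reach : ∀ S → length S < h → ∀ {v} → v ∉ S ++ X →
            ∃₂ λ o p → O o × Walk E o v p × (∀ {u} → u ∈ p → u ∉ S ++ X)

record Linkage {N n} (E : Fin N → Fin N → Set) (X : List (Fin N)) (O I : Fin n → Fin N → Set) : Set where
  field
    vs       : Fin n → List (Fin N)
    src tgt  : Fin n → Fin N
    walk     : ∀ j → Walk E (src j) (tgt j) (vs j)
    src∈     : ∀ j → O j (src j)
    tgt∈     : ∀ j → I j (tgt j)
    vs!      : ∀ j → Unique (vs j)
    disjoint : ∀ {i j v} → v ∈ vs i → v ∈ vs j → i ≡ j
    avoid    : ∀ {j v} → v ∈ vs j → v ∉ X
    cover    : ∀ {v} → v ∉ X → ∃ λ j → v ∈ vs j

least : {P : ℕ → Set} → Decidable P → ∀ n → P n → ∃ λ m → P m × (∀ k → k < m → ¬ P k)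
least {P} P? n pn with below n
  where
  below : ∀ n → (∃ λ m → P m × (∀ k → k < m → ¬ P k)) ⊎ (∀ k → k < n → ¬ P k)
  below zero    = inj₂ λ _ ()
  below (suc n) with below n
  ... | inj₁ r = inj₁ r
  ... | inj₂ b with P? n
  ...   | yes pn = inj₁ (n , pn , b)
  ...   | no ¬pn = inj₂ λ k k<n → case (m<1+n⇒m<n∨m≡n k<n)
    where
    case : ∀ {k} → k < n ⊎ k ≡ n → ¬ P k
    case (inj₁ k<n) = b _ k<n
    case (inj₂ refl) = ¬pn
... | inj₁ r = r
... | inj₂ b = n , pn , b

∈-take : {A : Set} (k : ℕ) {xs : List A} {x : A} → x ∈ xs →
         x ∈ take k xs ⊎ ∃₂ λ ys zs → xs ≡ ys ++ x ∷ zs × k ≤ length ys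
∈-take zero    i with ∈-∃++ i
... | ys , zs , eq = inj₂ (ys , zs , eq , z≤n)
∈-take (suc k) (here refl) = inj₁ (here refl)
∈-take (suc k) (there i) with ∈-take k i
... | inj₁ j = inj₁ (there j)
... | inj₂ (ys , zs , refl , l) = inj₂ (_ ∷ ys , zs , refl , s≤s l)

length-take-≤ : {A : Set} (k : ℕ) (xs : List A) → length (take k xs) ≤ k
length-take-≤ k xs = ≤-trans (≤-reflexive (length-take k xs)) (m⊓n≤m k (length xs))

module _ {N : ℕ} {E : Fin N → Fin N → Set} {O : Fin N → Set} where

  good-resp : ∀ {h X Y} → X ⊆ Y → Y ⊆ X → Good E h X O → Good E h Y O
  good-resp {h} {X} {Y} XY YX g = record
    { some = λ S l → let o , oo , o∉ = Good.some g S l in o , oo , o∉ ∘ back S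
    ; reach = λ S l v∉ → let o , p , oo , w , av = Good.reach g S l (v∉ ∘ forth S)
                         in o , p , oo , w , λ i → av i ∘ back S }
    where
    back : ∀ S → S ++ Y ⊆ S ++ X
    back S i with ∈-++⁻ S i
    ... | inj₁ j = ∈-++⁺ˡ j
    ... | inj₂ j = ∈-++⁺ʳ S (YX j)
    forth : ∀ S → S ++ X ⊆ S ++ Y
    forth S i with ∈-++⁻ S i
    ... | inj₁ j = ∈-++⁺ˡ j
    ... | inj₂ j = ∈-++⁺ʳ S (XY j)

  good-weaken : ∀ {h h′ X} → h′ ≤ h → Good E h X O → Good E h′ X O
  good-weaken le g = record
    { some = λ S l → Good.some g S (<-≤-trans l le) ; reach = λ S l → Good.reach g S (<-≤-trans l le) }

  good-remove : ∀ {h h′ X} x → suc h′ ≤ h → Good E h X O → Good E h′ (x ∷ X) O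
  good-remove {X = X} x le g = record
    { some = λ S l → let o , oo , o∉ = Good.some g (x ∷ S) (<-≤-trans (s≤s l) le)
                     in o , oo , o∉ ∘ ∈-resp-↭ (shift x S X)
    ; reach = λ S l v∉ → let o , p , oo , w , av = Good.reach g (x ∷ S) (<-≤-trans (s≤s l) le)
                                 (v∉ ∘ ∈-resp-↭ (↭-sym (shift x S X)))
                         in o , p , oo , w , λ i → av i ∘ ∈-resp-↭ (shift x S X) }

Near : ∀ {N} → (Fin N → Fin N → Set) → List (Fin N) → (Fin N → Set) → Fin N → Set
Near E X O u = O u ⊎ (∃ λ o → (O o × o ∉ X) × E o u) ⊎ (∃ λ o → (O o × o ∉ X) × ∃ λ w → w ∉ X × E o w × E w u)

record Shortest {N} (E : Fin N → Fin N → Set) (X : List (Fin N)) (O I : Fin N → Set) : Set where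
  field
    {src tgt} : Fin N
    {vs}      : List (Fin N)
    walk      : Walk E src tgt vs
    src∈      : O src
    tgt∈      : I tgt
    avoid     : ∀ {u} → u ∈ vs → u ∉ X
    minimal   : ∀ {s t q} → Walk E s t q → O s → I t → (∀ {u} → u ∈ q → u ∉ X) → length vs ≤ length q

shortest-reverse : ∀ {N} {E : Fin N → Fin N → Set} {X O I} → Shortest E X O I → Shortest (flip E) X I O
shortest-reverse P = record
  { walk = walk-reverse walk ; src∈ = tgt∈ ; tgt∈ = src∈ ; avoid = avoid ∘ AnyP.reverse⁻
  ; minimal = λ {_} {_} {q} w i o av →
      ≤-trans (≤-reflexive (length-reverse vs))
        (≤-trans (minimal (walk-reverse w) o i (av ∘ AnyP.reverse⁻)) (≤-reflexive (length-reverse q))) }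
  where open Shortest P

module Count {n : ℕ} where

  count : Fin n → List (Fin n) → ℕ
  count j ts = length (filter (_≟ j) ts)

  count-↭ : ∀ {j ts us} → ts ↭ us → count j ts ≡ count j us
  count-↭ {j} e = ↭-length (filter-↭ (_≟ j) e)

  count⇒∈ : ∀ {j ts} → 1 ≤ count j ts → j ∈ ts
  count⇒∈ {j} {ts} l with filter (_≟ j) ts in eq
  ... | x ∷ xs with ∈-filter⁻ (_≟ j) {xs = ts} (subst (x ∈_) (sym eq) (here refl))
  ...   | x∈ , refl = x∈

  count-drop : ∀ {j i ts c} → suc c ≤ count j (i ∷ ts) → c ≤ count j ts
  count-drop {j} {i} l with i ≟ j
  count-drop (s≤s l) | yes _ = l
  ... | no _  = ≤-trans (n≤1+n _) l

lefts : {A B : Set} → List (A ⊎ B) → List A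
lefts []            = []
lefts (inj₁ x ∷ xs) = x ∷ lefts xs
lefts (inj₂ _ ∷ xs) = lefts xs

length-lefts : {A B : Set} (xs : List (A ⊎ B)) → length (lefts xs) ≤ length xs
length-lefts []            = z≤n
length-lefts (inj₁ _ ∷ xs) = s≤s (length-lefts xs)
length-lefts (inj₂ _ ∷ xs) = m≤n⇒m≤1+n (length-lefts xs)

∈-lefts : {A B : Set} {xs : List (A ⊎ B)} {x : A} → inj₁ x ∈ xs → x ∈ lefts xs
∈-lefts {xs = inj₁ _ ∷ _} (here refl) = here refl
∈-lefts {xs = inj₁ _ ∷ _} (there i)   = there (∈-lefts i)
∈-lefts {xs = inj₂ _ ∷ _} (there i)   = ∈-lefts i

-- Tournaments

module Tournament {N : ℕ} (E : Fin N → Fin N → Set)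
  (total : ∀ {x y} → x ≢ y → E x y ⊎ E y x) (asym : ∀ {x y} → E x y → ¬ E y x) where

  open import Data.List.Membership.DecPropositional (_≟_ {N}) using (_∈?_)

  irrefl : ∀ {x} → ¬ E x x
  irrefl e = asym e e

  E? : ∀ x y → Dec (E x y)
  E? x y with x ≟ y
  ... | yes refl = no irrefl
  ... | no ne with total ne
  ...   | inj₁ e = yes e
  ...   | inj₂ e = no (asym e)

  flipped : ∀ {x y} → x ≢ y → ¬ E x y → E y x
  flipped ne ¬e with total ne
  ... | inj₁ e = ⊥-elim (¬e e)
  ... | inj₂ e = e

  private
    ∉⇒≢ : ∀ {g u} {p : List (Fin N)} → g ∉ p → u ∈ p → u ≢ g
    ∉⇒≢ g∉ u∈ refl = g∉ u∈

  -- If `g` fits nowhere, no vertex with an arc to `g` is directly followed by one with an arc from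
  -- `g`. Along the path the out-neighbours of `g` therefore precede its in-neighbours, and each
  -- kind, if present, shows at its own end of the path.
  insert : ∀ {s t p} g → Walk E s t p → g ∉ p →
           (∃ λ q → Walk E s t q × q ↭ g ∷ p) ⊎
           ((∀ {u} → u ∈ p → E u g → E t g) × (∀ {u} → u ∈ p → E g u → E g s))
  insert g (stop s) g∉ = inj₂ ((λ { (here refl) e → e }) , λ { (here refl) e → e })
  insert g (_▸_ {x = s} {y = v} e w) g∉ with insert g w (g∉ ∘ there)
  ... | inj₁ (q , wq , pq) = inj₁ (_ , e ▸ wq , ↭-trans (prep s pq) (swap s g ↭-refl))
  ... | inj₂ (into , out) with E? s g | E? g v
  ...   | yes e₁ | yes e₂ = inj₁ (_ , e₁ ▸ e₂ ▸ w , swap s g ↭-refl)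
  ...   | yes e₁ | no ¬e₂ =
    inj₂ ((λ { (here refl) _ → into (head∈ w) (flipped (∉⇒≢ g∉ (there (head∈ w)) ∘ sym) ¬e₂)
             ; (there i) e → into i e })
         , λ { (here refl) e → e ; (there i) e → ⊥-elim (¬e₂ (out i e)) })
  ...   | no ¬e₁ | _ =
    inj₂ ((λ { (here refl) e → ⊥-elim (¬e₁ e) ; (there i) e → into i e })
         , λ _ _ → flipped (∉⇒≢ g∉ (here refl)) ¬e₁)

  -- In the `mixed` case `g` closes the path into a cycle.
  data Position (s t : Fin N) (p : List (Fin N)) (g : Fin N) : Set where
    inserted : ∀ q → Walk E s t q → q ↭ g ∷ p → Position s t p g
    mixed    : E t g → E g s → Position s t p g
    beyond   : All (λ u → E u g) p → Position s t p g
    before   : All (E g) p → Position s t p g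

  position : ∀ {s t p} g → Walk E s t p → g ∉ p → Position s t p g
  position {s} {t} {p} g w g∉ with insert g w g∉
  ... | inj₁ (q , wq , pq) = inserted q wq pq
  ... | inj₂ (into , out) with E? t g | E? g s
  ...   | yes e | yes e′ = mixed e e′
  ...   | _     | no ¬e  = beyond (All.tabulate λ u∈ → flipped (∉⇒≢ g∉ u∈ ∘ sym) (¬e ∘ out u∈))
  ...   | no ¬e | yes _  = before (All.tabulate λ u∈ → flipped (∉⇒≢ g∉ u∈) (¬e ∘ into u∈))

  rotate-to : ∀ {s t c v} → Walk E s t c → E t s → v ∈ c →
              ∃₂ λ t′ c′ → Walk E v t′ c′ × E t′ v × c′ ↭ c
  rotate-to {c = c} w e v∈ with ∈-∃++ v∈
  ... | []    , B , refl with walk-head w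
  ...   | _ , refl = _ , _ , w , e , ↭-refl
  rotate-to w e v∈ | a ∷ A , B , refl with walk-cut a A _ B w
  ... | y , w₁ , r , w₂ = y , _ , walk-++ w₂ e w₁ , r , ++-comm (_ ∷ B) (a ∷ A)

  rotate-from : ∀ {s t c v} → Walk E s t c → E t s → v ∈ c →
                ∃₂ λ s′ c′ → Walk E s′ v c′ × E v s′ × c′ ↭ c
  rotate-from {s} {t} {v = v} w e v∈ with ∈-∃++ v∈
  ... | A , [] , refl with walk-prefix A w
  ...   | w′ = s , A ++ v ∷ [] , w′ , subst (λ z → E z s) (lastEq A w) e , ↭-refl
    where
    lastEq : ∀ A {x y z} → Walk E x y (A ++ z ∷ []) → y ≡ z
    lastEq []           (stop _) = refl
    lastEq []           (_ ▸ ())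
    lastEq (_ ∷ [])     (_ ▸ w)  = lastEq [] w
    lastEq (_ ∷ b ∷ A)  (_ ▸ w)  = lastEq (b ∷ A) w
  rotate-from {s} {t} {v = v} w e v∈ | A , b ∷ B , refl with snoc A w
    where
    snoc : ∀ A {x y z b B} → Walk E x y (A ++ z ∷ b ∷ B) → Walk E x z (A ++ z ∷ []) × E z b × Walk E b y (b ∷ B)
    snoc []          (e ▸ w) with walk-head w
    ... | _ , refl = stop _ , e , w
    snoc (_ ∷ [])    (e ▸ w) with walk-head w | snoc [] w
    ... | _ , refl | stop _ , r , w₂ = e ▸ stop _ , r , w₂
    ... | _ , refl | (_ ▸ ()) , _ , _
    snoc (_ ∷ a ∷ A) (e ▸ w) with snoc (a ∷ A) w
    ... | w₁ , r , w₂ = e ▸ w₁ , r , w₂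
  ... | w₁ , r , w₂ = b , _ , walk-++ w₂ e w₁ , r ,
        ↭-trans (++-comm (b ∷ B) (A ++ v ∷ [])) (↭-reflexive (++-assoc A (v ∷ []) (b ∷ B)))

  -- Spanning paths and cycles of the leftover tournament.

  module Traverse (G : List (Fin N)) (G! : Unique G) (Entry Exit : Fin N → Set)
    (entry : ∀ {h} → h ∈ G → ∃₂ λ e p → Walk E e h p × p ⊆ G × Entry e)
    (exit  : ∀ {h} → h ∈ G → ∃₂ λ x p → Walk E h x p × p ⊆ G × Exit x) where

    data Traversal : Set where
      path  : ∀ {e x} γ → Walk E e x γ → γ ↭ G → Entry e → Exit x → Traversal
      cycle : ∀ {s t} γ → Walk E s t γ → E t s → γ ↭ G → Traversal

    -- A cycle remembers an entry and an exit on it so that it can be reopened: a new entry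
    -- dominating the whole cycle is put before the path that ends in the old exit, and
    -- symmetrically for a new exit.
    data Partial : List (Fin N) → Set where
      path  : ∀ {e x q} → Walk E e x q → Entry e → Exit x → Partial q
      cycle : ∀ {s t q e x} → Walk E s t q → E t s → e ∈ q → Entry e → x ∈ q → Exit x → Partial q

    private
      add : ∀ {a q q′ H H′} → q′ ↭ a ∷ q → H ↭ a ∷ H′ → q ++ H ↭ G → q′ ++ H′ ↭ G
      add {a} {q} {H′ = H′} pq pH pG =
        ↭-trans (++⁺ʳ H′ pq) (↭-trans (↭-sym (shift a q H′)) (↭-trans (++⁺ˡ q (↭-sym pH)) pG))

      shorter : ∀ {a : Fin N} {H H′ n} → H ↭ a ∷ H′ → length H ≤ suc n → length H′ ≤ n
      shorter e l with ≤-trans (≤-reflexive (sym (↭-length e))) l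
      ... | s≤s l′ = l′

      split-∉ : ∀ {q H} → q ++ H ↭ G → ∀ {v} → v ∈ H → v ∉ q
      split-∉ {q} e v∈H v∈q = proj₂ (proj₂ (Unique-++ q (Unique-↭ (↭-sym e) G!))) v∈q v∈H

      other : ∀ {q H v} → q ++ H ↭ G → v ∈ G → v ∉ q → v ∈ H
      other {q} e v∈ v∉ with ∈-++⁻ q (∈-resp-↭ (↭-sym e) v∈)
      ... | inj₁ i = ⊥-elim (v∉ i)
      ... | inj₂ i = i

      snoc↭ : ∀ (a : Fin N) q → q ++ a ∷ [] ↭ a ∷ q
      snoc↭ a q = ↭-sym (∷↭∷ʳ a q)

      rest : ∀ {a b : Fin N} {H H′} → H ↭ a ∷ H′ → b ∈ H → b ≢ a → ∃ λ H″ → H′ ↭ b ∷ H″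
      rest e b∈ b≢a with ∈-resp-↭ e b∈
      ... | here eq = ⊥-elim (b≢a eq)
      ... | there i = ∈⇒↭ i

    -- The leftover vertices that all of q dominates can only be left through a vertex
    -- dominating all of q, or at an exit.
    data Next (s t : Fin N) (q H : List (Fin N)) : Set where
      longer  : ∀ {a q′ H′} → H ↭ a ∷ H′ → Walk E s t q′ → q′ ↭ a ∷ q → Next s t q H
      closing : ∀ {a H′} → H ↭ a ∷ H′ → E t a → E a s → Next s t q H
      closing₂ : ∀ {a b H′ H″} → H ↭ a ∷ H′ → H′ ↭ b ∷ H″ → E t a → E a b → E b s → Next s t q H
      front   : ∀ {e H′} → H ↭ e ∷ H′ → Entry e → All (E e) q → Next s t q H
      back    : ∀ {x H′} → H ↭ x ∷ H′ → Exit x → All (λ u → E u x) q → Next s t q H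

    next : ∀ {s t q h H} → Walk E s t q → q ++ (h ∷ H) ↭ G → Next s t q (h ∷ H)
    next {s} {t} {q} {h} {H} w pG with position h w (split-∉ {q} pG (here refl))
    ... | inserted q′ w′ pq = longer ↭-refl w′ pq
    ... | mixed e e′ = closing ↭-refl e e′
    ... | beyond al with exit (∈-resp-↭ pG (∈-++⁺ʳ q (here refl)))
    ...   | x , p , wp , p⊆ , ex with all? (λ u → E? u x) q
    ...     | yes alx with ∈⇒↭ (other {q} pG (p⊆ (last∈ wp)) (λ x∈q → irrefl (lookup alx x∈q)))
    ...       | _ , eH = back eH ex alx
    next {s} {t} {q} {h} {H} w pG | beyond al | x , p , wp , p⊆ , ex | no ¬alx
      with crossing (λ v → all? (λ u → E? u v) q) wp al ¬alx
    -- All of `q` dominates `a` but not `b`. Neither lies on `q`: `a` would dominate itself, and `b`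
    -- would dominate `a` as well as be dominated by it in the mirrored case. If `b` dominates all
    -- of `q`, then `a`, `b` close `q` into a cycle.
    ... | a , b , a∈ , b∈ , r , ala , ¬alb
      with other {q} pG (p⊆ a∈) (λ i → irrefl (lookup ala i)) | other {q} pG (p⊆ b∈) (λ i → asym (lookup ala i) r)
    ... | a∈H | b∈H with position b w (split-∉ {q} pG b∈H) | ∈⇒↭ b∈H | ∈⇒↭ a∈H
    ... | inserted q′ w′ pq | _ , eH | _ = longer eH w′ pq
    ... | mixed e e′ | _ , eH | _ = closing eH e e′
    ... | beyond alb | _ | _ = ⊥-elim (¬alb alb)
    ... | before alb | _ | _ , eH with rest eH b∈H (λ { refl → irrefl r })
    ...   | _ , eH′ = closing₂ eH eH′ (lookup ala (last∈ w)) r (lookup alb (head∈ w))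
    next {s} {t} {q} {h} {H} w pG | before al with entry (∈-resp-↭ pG (∈-++⁺ʳ q (here refl)))
    ... | x , p , wp , p⊆ , ex with all? (E? x) q
    ...     | yes alx with ∈⇒↭ (other {q} pG (p⊆ (head∈ wp)) (λ x∈q → irrefl (lookup alx x∈q)))
    ...       | _ , eH = front eH ex alx
    next {s} {t} {q} {h} {H} w pG | before al | x , p , wp , p⊆ , ex | no ¬alx
      with crossing (λ v → ¬? (all? (E? v) q)) wp ¬alx (λ k → k al)
    ... | a , b , a∈ , b∈ , r , ¬ala , ¬¬alb with all? (E? b) q
    ... | no ¬alb = ⊥-elim (¬¬alb ¬alb)
    ... | yes alb
      with other {q} pG (p⊆ a∈) (λ i → asym (lookup alb i) r) | other {q} pG (p⊆ b∈) (λ i → irrefl (lookup alb i))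
    ... | a∈H | b∈H with position a w (split-∉ {q} pG a∈H) | ∈⇒↭ a∈H
    ... | inserted q′ w′ pq | _ , eH = longer eH w′ pq
    ... | mixed e e′ | _ , eH = closing eH e e′
    ... | before ala | _ = ⊥-elim (¬ala ala)
    ... | beyond ala | _ , eH with rest eH b∈H (λ { refl → irrefl r })
    ...   | _ , eH′ = closing₂ eH eH′ (lookup ala (last∈ w)) r (lookup alb (head∈ w))

    grow : ∀ n {q H} → length H ≤ n → Partial q → q ++ H ↭ G → Traversal
    grow n {q} {[]} _ (path w e x) pG = path q w (↭-trans (↭-reflexive (sym (++-identityʳ q))) pG) e x
    grow n {q} {[]} _ (cycle w e _ _ _ _) pG = cycle q w e (↭-trans (↭-reflexive (sym (++-identityʳ q))) pG)
    grow zero {H = h ∷ H} () _ _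
    grow (suc n) {q} {h ∷ H} l (path w en ex) pG with next w pG
    ... | longer eH w′ pq = grow n (shorter eH l) (path w′ en ex) (add pq eH pG)
    ... | closing {a} eH r r′ =
      grow n (shorter eH l)
        (cycle (walk-++ w r (stop a)) r′ (∈-++⁺ˡ (head∈ w)) en (∈-++⁺ˡ (last∈ w)) ex)
        (add (snoc↭ a q) eH pG)
    ... | closing₂ {a} {b} eH eH′ r r′ r″ =
      grow n (≤-trans (n≤ eH′) (shorter eH l))
        (cycle (walk-++ (walk-++ w r (stop a)) r′ (stop b)) r″
          (∈-++⁺ˡ (∈-++⁺ˡ (head∈ w))) en (∈-++⁺ˡ (∈-++⁺ˡ (last∈ w))) ex)
        (add (snoc↭ b (q ++ a ∷ [])) eH′ (add (snoc↭ a q) eH pG))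
      where
      n≤ : ∀ {a : Fin N} {H H′} → H ↭ a ∷ H′ → length H′ ≤ length H
      n≤ e = ≤-trans (n≤1+n _) (≤-reflexive (sym (↭-length e)))
    ... | front eH en′ al = grow n (shorter eH l) (path (lookup al (head∈ w) ▸ w) en′ ex) (add ↭-refl eH pG)
    ... | back {x} eH ex′ al =
      grow n (shorter eH l) (path (walk-++ w (lookup al (last∈ w)) (stop x)) en ex′) (add (snoc↭ x q) eH pG)
    grow (suc n) {q} {h ∷ H} l (cycle w c e∈ en x∈ ex) pG with next w pG
    ... | longer eH w′ pq =
      grow n (shorter eH l)
        (cycle w′ c (∈-resp-↭ (↭-sym pq) (there e∈)) en (∈-resp-↭ (↭-sym pq) (there x∈)) ex) (add pq eH pG)
    ... | closing {a} eH r r′ =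
      grow n (shorter eH l)
        (cycle (walk-++ w r (stop a)) r′ (∈-++⁺ˡ e∈) en (∈-++⁺ˡ x∈) ex) (add (snoc↭ a q) eH pG)
    ... | closing₂ {a} {b} eH eH′ r r′ r″ =
      grow n (≤-trans (n≤ eH′) (shorter eH l))
        (cycle (walk-++ (walk-++ w r (stop a)) r′ (stop b)) r″ (∈-++⁺ˡ (∈-++⁺ˡ e∈)) en (∈-++⁺ˡ (∈-++⁺ˡ x∈)) ex)
        (add (snoc↭ b (q ++ a ∷ [])) eH′ (add (snoc↭ a q) eH pG))
      where
      n≤ : ∀ {a : Fin N} {H H′} → H ↭ a ∷ H′ → length H′ ≤ length H
      n≤ e = ≤-trans (n≤1+n _) (≤-reflexive (sym (↭-length e)))
    ... | front eH en′ al with rotate-from w c x∈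
    ...   | s′ , q′ , w′ , _ , pq =
      grow n (shorter eH l) (path (lookup al (∈-resp-↭ pq (head∈ w′)) ▸ w′) en′ ex) (add (prep _ pq) eH pG)
    grow (suc n) {q} {h ∷ H} l (cycle w c e∈ en x∈ ex) pG | back {x} eH ex′ al with rotate-to w c e∈
    ...   | t′ , q′ , w′ , _ , pq =
      grow n (shorter eH l) (path (walk-++ w′ (lookup al (∈-resp-↭ pq (last∈ w′))) (stop x)) en ex′)
        (add (↭-trans (snoc↭ x q′) (prep x pq)) eH pG)

    traversal : ∀ {h} → h ∈ G → Traversal
    traversal {h} h∈ with entry h∈ | exit h∈
    ... | e , p , wp , p⊆ , en | x , _ , wr , r⊆ , ex with walk-head wr
    ... | r , refl with walk-simple _≟_ (walk-join wp wr)
    ... | q , w , q! , q⊆ with complement q! (λ i → sub (q⊆ i))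
      where
      sub : p ++ r ⊆ G
      sub i with ∈-++⁻ p i
      ... | inj₁ j = p⊆ j
      ... | inj₂ j = r⊆ (there j)
    ... | H , pG = grow (length H) ≤-refl (path w en ex) pG

  -- As in merging sorted lists: of the two first vertices, the one that dominates the other goes
  -- first. It has an arc to the first vertex of the remaining merge, whichever path that comes
  -- from.
  merge : ∀ {s t p s′ t′ q} → Walk E s t p → Walk E s′ t′ q → (∀ {u} → u ∈ p → u ∉ q) →
          ∃₂ λ a b → ∃ λ r → Walk E a b r × r ↭ p ++ q × (a ≡ s ⊎ a ≡ s′) × (b ≡ t ⊎ b ≡ t′)
  merge {s} {s′ = s′} w w′ d with total {s} {s′} (λ { refl → d (head∈ w) (head∈ w′) })
  merge (stop s) w′ d | inj₁ e = s , _ , _ , e ▸ w′ , ↭-refl , inj₁ refl , inj₂ refl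
  merge {s} {s′ = s′} (e₀ ▸ w) w′ d | inj₁ e with merge w w′ (d ∘ there)
  ... | a , b , r , wr , pr , hd , tl = s , b , _ , step hd ▸ wr , prep s pr , inj₁ refl , tl
    where
    step : a ≡ _ ⊎ a ≡ s′ → E s a
    step (inj₁ refl) = e₀
    step (inj₂ refl) = e
  merge {p = p} w (stop s′) d | inj₂ e =
    s′ , _ , _ , e ▸ w , ∷↭∷ʳ s′ p , inj₂ refl , inj₁ refl
  merge {s} {p = p} {s′ = s′} w (e₀ ▸ w′) d | inj₂ e with merge w w′ (λ i j → d i (there j))
  ... | a , b , r , wr , pr , hd , tl =
    s′ , b , _ , step hd ▸ wr , ↭-trans (prep s′ pr) (↭-sym (shift s′ p _)) , inj₂ refl , tl
    where
    step : a ≡ s ⊎ a ≡ _ → E s′ a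
    step (inj₁ refl) = e
    step (inj₂ refl) = e₀

  -- Families of typed paths and the absorption of leftover vertices.

  module Absorb {n : ℕ} (O : Fin N → Set) (I : Fin n → Fin N → Set) (X : List (Fin N)) where

    open Count {n}

    -- Sources all lie in the one set `O`, so `type` restricts the target only, and a concatenation
    -- of threads inherits the type of its last member.
    record Thread : Set where
      constructor thread
      field
        type      : Fin n
        {src tgt} : Fin N
        {vs}      : List (Fin N)
        walk      : Walk E src tgt vs
        src∈      : O src
        tgt∈      : I type tgt
    open Thread

    verts : List Thread → List (Fin N)
    verts = concatMap vs

    types : List Thread → List (Fin n)
    types = map type

    W : List (Fin N)
    W = filter (λ v → ¬? (v ∈? X)) (allFin N)

    W! : Unique W
    W! = Uniqueₚ.filter⁺ (λ v → ¬? (v ∈? X)) (Uniqueₚ.allFin⁺ N)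

    ∈W : ∀ {v} → v ∉ X → v ∈ W
    ∈W = ∈-filter⁺ (λ v → ¬? (v ∈? X)) (∈-allFin _)

    W∌ : ∀ {v} → v ∈ W → v ∉ X
    W∌ i = proj₂ (∈-filter⁻ (λ v → ¬? (v ∈? X)) {xs = allFin N} i)

    In Out : Fin N → Thread → Set
    In  g e = E (tgt e) g
    Out g e = E g (src e)

    -- The second outcome of `insert`: as far as arcs to and from `g` are concerned, the two ends
    -- stand for the whole thread.
    Blocked : Fin N → Thread → Set
    Blocked g e = (∀ {u} → u ∈ vs e → E u g → In g e) × (∀ {u} → u ∈ vs e → E g u → Out g e)

    insertAny : ∀ g fam → g ∉ verts fam →
                (∃ λ fam′ → verts fam′ ↭ g ∷ verts fam × types fam′ ≡ types fam) ⊎ (∀ {e} → e ∈ fam → Blocked g e)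
    insertAny g []        _  = inj₂ λ ()
    insertAny g (e ∷ fam) g∉ with insert g (walk e) (g∉ ∘ ∈-++⁺ˡ) | insertAny g fam (g∉ ∘ ∈-++⁺ʳ (vs e))
    ... | inj₁ (q , w , pq) | _ =
      inj₁ (thread (type e) w (src∈ e) (tgt∈ e) ∷ fam , ++⁺ʳ (verts fam) pq , refl)
    ... | inj₂ _ | inj₁ (fam′ , pf , eq) =
      inj₁ (e ∷ fam′ , ↭-trans (++⁺ˡ (vs e) pf) (shift g (vs e) (verts fam)) , cong (type e ∷_) eq)
    ... | inj₂ b | inj₂ bs = inj₂ λ { (here refl) → b ; (there i) → bs i }

    insertSome : ∀ G fam → (∀ {g} → g ∈ G → g ∉ verts fam) →
      (∃₂ λ g G′ → ∃ λ fam′ → G ↭ g ∷ G′ × verts fam′ ↭ g ∷ verts fam × types fam′ ≡ types fam) ⊎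
      (∀ {g e} → g ∈ G → e ∈ fam → Blocked g e)
    insertSome []      fam d = inj₂ λ ()
    insertSome (g ∷ G) fam d with insertAny g fam (d (here refl)) | insertSome G fam (d ∘ there)
    ... | inj₁ (fam′ , pf , eq) | _ = inj₁ (g , G , fam′ , ↭-refl , pf , eq)
    ... | inj₂ _ | inj₁ (g′ , G′ , fam′ , pG , r) =
      inj₁ (g′ , g ∷ G′ , fam′ , ↭-trans (prep g pG) (swap g g′ ↭-refl) , r)
    ... | inj₂ b | inj₂ bs = inj₂ λ { (here refl) → b ; (there i) → bs i }

    record Saturated (ts : List (Fin n)) : Set where
      field
        G       : List (Fin N)
        fam     : List Thread
        perm    : G ++ verts fam ↭ W
        types≡  : types fam ≡ ts
        blocked : ∀ {g e} → g ∈ G → e ∈ fam → Blocked g e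

    saturate : ∀ m G fam → length G ≤ m → G ++ verts fam ↭ W → Saturated (types fam)
    saturate m G fam l p with insertSome G fam (λ i → proj₂ (proj₂ (Unique-++ G (Unique-↭ (↭-sym p) W!))) i)
    ... | inj₂ b = record { G = G ; fam = fam ; perm = p ; types≡ = refl ; blocked = b }
    ... | inj₁ (g , G′ , fam′ , pG , pf , eq) with m | ≤-trans (≤-reflexive (sym (↭-length pG))) l
    ...   | suc m′ | s≤s l′ = subst Saturated eq (saturate m′ G′ fam′ l′ perm′)
      where
      perm′ : G′ ++ verts fam′ ↭ W
      perm′ = ↭-trans (++⁺ˡ G′ pf) (↭-trans (shift g G′ (verts fam)) (↭-trans (++⁺ʳ (verts fam) (↭-sym pG)) p))

    -- A type may still have several threads; `gather` merges them.
    Cover : Set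
    Cover = ∃ λ fam → verts fam ↭ W × (∀ j → j ∈ types fam)

    module Leftover {fam : List Thread} (three : ∀ j → 3 ≤ count j (types fam)) (j₀ : Fin n)
      {G : List (Fin N)} (perm : G ++ verts fam ↭ W)
      (blocked : ∀ {g e} → g ∈ G → e ∈ fam → Blocked g e) where

      private
        drop₁ : ∀ {a fam′} → fam ↭ a ∷ fam′ → ∀ j → 2 ≤ count j (types fam′)
        drop₁ {a} {fam′} e j = count-drop {i = type a} {types fam′}
          (≤-trans (three j) (≤-reflexive (count-↭ {j} (map⁺ type e))))

        splitG = Unique-++ G (Unique-↭ (↭-sym perm) W!)

        src≢ : ∀ {g e} → g ∈ G → e ∈ fam → src e ≢ g
        src≢ {e = e} g∈ e∈ refl = proj₂ (proj₂ splitG) g∈ (concatMap-∈⁺ vs e∈ (head∈ (walk e)))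

        -- Without an arc from `g` to the first vertex of the thread there is one in the opposite
        -- direction, and blockedness passes it on to the last vertex.
        in-or-out : ∀ {g e} → g ∈ G → e ∈ fam → ¬ Out g e → In g e
        in-or-out {g} {e} g∈ e∈ ¬o =
          proj₁ (blocked g∈ e∈) (head∈ (walk e)) (flipped (src≢ g∈ e∈ ∘ sym) ¬o)

        out-or-in : ∀ {g e} → g ∈ G → e ∈ fam → ¬ In g e → Out g e
        out-or-in {g} {e} g∈ e∈ ¬i with E? g (src e)
        ... | yes o = o
        ... | no ¬o = ⊥-elim (¬i (in-or-out g∈ e∈ ¬o))

        from-fam : ∀ {a} {es : List Thread} → fam ↭ es → a ∈ es → a ∈ fam
        from-fam e i = ∈-resp-↭ (↭-sym e) i

        joined-perm : ∀ {γ a b fs} → γ ↭ G → fam ↭ a ∷ b ∷ fs → (vs a ++ γ ++ vs b) ++ verts fs ↭ W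
        joined-perm {γ} {a} {b} {fs} pγ e =
          ↭-trans (lem (vs a) γ (vs b) (verts fs))
            (↭-trans (++⁺ pγ (↭-sym (concatMap-↭ vs e))) perm)
          where
          open import Algebra.Solver.CommutativeMonoid (++-commutativeMonoid {A = Fin N})
          lem : ∀ a b c d → (a ++ b ++ c) ++ d ↭ b ++ a ++ c ++ d
          lem a b c d = prove 4 ((x ⊕ (y ⊕ z)) ⊕ w) (y ⊕ (x ⊕ (z ⊕ w))) (a Vec.∷ b Vec.∷ c Vec.∷ d Vec.∷ Vec.[])
            where x = var 0F ; y = var 1F ; z = var 2F ; w = var 3F

      direct : ∀ {q p γ} → Walk E q p γ → γ ↭ G →
               (O q ⊎ ∃ λ a → a ∈ fam × In q a) → (∃ λ j → I j p) → Cover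
      direct w pγ (inj₁ o) (j , i) =
        thread j w o i ∷ fam , ↭-trans (++⁺ʳ (verts fam) pγ) perm ,
        λ j′ → there (count⇒∈ (≤-trans (s≤s z≤n) (three j′)))
      direct {γ = γ} w pγ (inj₂ (a , a∈ , r)) (j , i) with ∈⇒↭ a∈
      ... | fs , e =
        thread j (walk-++ (walk a) r w) (src∈ a) i ∷ fs ,
        ↭-trans (lem (vs a) γ (verts fs)) (↭-trans (++⁺ pγ (↭-sym (concatMap-↭ vs e))) perm) ,
        λ j′ → there (count⇒∈ (≤-trans (s≤s z≤n) (drop₁ e j′)))
        where
        lem : ∀ a b c → (a ++ b) ++ c ↭ b ++ a ++ c
        lem a b c = ↭-trans (↭-reflexive (++-assoc a b c)) (shifts a b)

      direct-in : ∀ {q p γ} → Walk E q p γ → γ ↭ G → O q → ∀ {b} → b ∈ fam → Out p b → Cover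
      direct-in {γ = γ} w pγ o {b} b∈ r with ∈⇒↭ b∈
      ... | fs , e =
        thread (type b) (walk-++ w r (walk b)) o (tgt∈ b) ∷ fs ,
        ↭-trans (↭-reflexive (++-assoc γ (vs b) (verts fs))) (↭-trans (++⁺ pγ (↭-sym (concatMap-↭ vs e))) perm) ,
        λ j′ → count⇒∈ {ts = type b ∷ types fs}
            (≤-trans (s≤s z≤n) (≤-trans (three j′) (≤-reflexive (count-↭ {j′} (map⁺ type e)))))

      -- The result has the type of `b`, so only the type of `a` loses a member.
      through : ∀ {q p γ a b fs} → Walk E q p γ → γ ↭ G → fam ↭ a ∷ b ∷ fs → In q a → Out p b → Cover
      through {a = a} {b} {fs} w pγ e r r′ =
        thread (type b) (walk-++ (walk a) r (walk-++ w r′ (walk b))) (src∈ a) (tgt∈ b) ∷ fs ,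
        joined-perm {a = a} {b} pγ e ,
        λ j′ → count⇒∈ {ts = type b ∷ types fs} (≤-trans (s≤s z≤n) (drop₁ e j′))

      -- Three threads become one with the type of `b`. Giving up `a` and `c` takes at most two
      -- members from any type; this is the case that requires three of each.
      chain : ∀ {q g h x γ₁ γ₂ a b c fs} → Walk E q g γ₁ → Walk E h x γ₂ → γ₁ ++ γ₂ ↭ G → fam ↭ a ∷ b ∷ c ∷ fs →
              In q a → Out x a → Out g b → In h c → Cover
      chain {γ₁ = γ₁} {γ₂} {a} {b} {c} {fs} w₁ w₂ pγ e r₁ r₂ r₃ r₄ =
        thread (type b) (walk-++ (walk c) r₄ (walk-++ w₂ r₂ (walk-++ (walk a) r₁ (walk-++ w₁ r₃ (walk b)))))
          (src∈ c) (tgt∈ b) ∷ fs ,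
        ↭-trans (lem (vs c) γ₂ (vs a) γ₁ (vs b) (verts fs)) (↭-trans (++⁺ pγ (↭-sym (concatMap-↭ vs e))) perm) ,
        λ j′ → count⇒∈ {ts = type b ∷ types fs}
          (count-drop {i = type c} {type b ∷ types fs}
              (≤-trans (drop₁ e j′) (≤-reflexive (count-↭ {j′} (swap (type b) (type c) ↭-refl)))))
        where
        open import Algebra.Solver.CommutativeMonoid (++-commutativeMonoid {A = Fin N})
        lem : ∀ c g a f b d → (c ++ g ++ a ++ f ++ b) ++ d ↭ (f ++ g) ++ a ++ b ++ c ++ d
        lem c g a f b d = prove 6 ((x₀ ⊕ (x₁ ⊕ (x₂ ⊕ (x₃ ⊕ x₄)))) ⊕ x₅) ((x₃ ⊕ x₁) ⊕ (x₂ ⊕ (x₄ ⊕ (x₀ ⊕ x₅))))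
          (c Vec.∷ g Vec.∷ a Vec.∷ f Vec.∷ b Vec.∷ d Vec.∷ Vec.[])
          where x₀ = var 0F ; x₁ = var 1F ; x₂ = var 2F ; x₃ = var 3F ; x₄ = var 4F ; x₅ = var 5F

      -- Both ends of γ = q…p attach to the same thread a.  If g on γ leads to b and c, and c (say) leads
      -- to the next vertex h, then c h…p a q…g b is a single thread; otherwise h leads to b and c as well.
      module Scan {a b c fs q p} (e : fam ↭ a ∷ b ∷ c ∷ fs) (r : In q a) (r′ : Out p a) where

        private
          a∈ = from-fam e (here refl)
          b∈ = from-fam e (there (here refl))
          c∈ = from-fam e (there (there (here refl)))

        scan : ∀ {g h γ₁ γ₂} → Walk E q g γ₁ → E g h → Walk E h p γ₂ → γ₁ ++ γ₂ ↭ G →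
               Out g b → Out g c → Cover
        scan {h = h} {γ₁} w₁ s w₂ pγ ob oc with E? (tgt c) h | E? (tgt b) h
        ... | yes ic | _ = chain w₁ w₂ pγ e r r′ ob ic
        ... | no _ | yes ib = chain w₁ w₂ pγ (↭-trans e (prep a (swap b c ↭-refl))) r r′ oc ib
        scan {h = h} {γ₁} w₁ s (stop _) pγ ob oc | no ¬ic | no ¬ib =
          through (walk-++ w₁ s (stop h)) pγ e r (out-or-in (∈-resp-↭ pγ (∈-++⁺ʳ γ₁ (here refl))) b∈ ¬ib)
        scan {h = h} {γ₁} w₁ s (s′ ▸ w₂) pγ ob oc | no ¬ic | no ¬ib =
          scan (walk-++ w₁ s (stop h)) s′ w₂ (↭-trans (↭-reflexive (++-assoc γ₁ (h ∷ []) _)) pγ)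
            (out-or-in h∈ b∈ ¬ib) (out-or-in h∈ c∈ ¬ic)
          where h∈ = ∈-resp-↭ pγ (∈-++⁺ʳ γ₁ (here refl))

        start : ∀ {γ} → Walk E q p γ → γ ↭ G → Cover
        -- If `b` or `c` leads to `q`, it takes the place of `a` in front of `γ`, and `a` follows
        -- `γ`. Otherwise `q` leads to both.
        start w pγ with E? (tgt b) q | E? (tgt c) q
        ... | yes ib | _ = through w pγ (↭-trans e (swap a b ↭-refl)) ib r′
        ... | no _ | yes ic = through w pγ (↭-trans e (↭-trans (prep a (swap b c ↭-refl)) (swap a c ↭-refl))) ic r′
        start (stop _) pγ | no ¬ib | no _ = through (stop _) pγ e r (out-or-in (∈-resp-↭ pγ (here refl)) b∈ ¬ib)
        start (s ▸ w) pγ | no ¬ib | no ¬ic =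
          scan (stop q) s w pγ (out-or-in q∈ b∈ ¬ib) (out-or-in q∈ c∈ ¬ic)
          where q∈ = ∈-resp-↭ pγ (here refl)

      pick : ∃₂ λ a fs → fam ↭ a ∷ fs
      pick = split fam (≤-trans (three j₀) (length-filter (_≟ j₀) (types fam)))
        where
        split : ∀ es → 3 ≤ length (types es) → ∃₂ λ a fs → es ↭ a ∷ fs
        split (a ∷ fs) _ = a , fs , ↭-refl

      others : ∀ {a} → a ∈ fam → ∃₂ λ b c → ∃ λ fs → fam ↭ a ∷ b ∷ c ∷ fs
      others a∈ with ∈⇒↭ a∈
      ... | fs , e with fs | e | ≤-trans (drop₁ e j₀) (length-filter (_≟ j₀) (types fs))
      ... | b ∷ c ∷ fs′ | e′ | _ = b , c , fs′ , e′
      ... | b ∷ [] | _ | s≤s ()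

      -- Two threads rather than one, so that whichever thread the far end leads to, another is free
      -- to lead in.
      Rich : Fin N → Set
      Rich q = O q ⊎ ∃₂ λ a b → ∃ λ fs → fam ↭ a ∷ b ∷ fs × In q a × In q b

      module Cyclic (I? : ∀ j v → Dec (I j v)) where

        -- Since `q` is rich, any exit at `p` completes a cover. If `p` has none, it leads to no
        -- thread, so every thread leads to `p`, which makes `p` rich.
        turn : ∀ {q p γ} → Walk E q p γ → γ ↭ G → Rich q →
               Cover ⊎ (Rich p × (∀ {b} → b ∈ fam → ¬ Out p b) × ¬ (∃ λ j → I j p))
        turn {q} {p} w pγ rich with any? (λ j → I? j p) | Any.any? (λ b → E? p (src b)) fam
        ... | yes i | _ with rich
        ...   | inj₁ o = inj₁ (direct w pγ (inj₁ o) i)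
        ...   | inj₂ (a , _ , _ , e , r , _) = inj₁ (direct w pγ (inj₂ (a , from-fam e (here refl) , r)) i)
        turn {q} {p} w pγ rich | no _ | yes out with find out
        ... | c , c∈ , r′ with rich
        ...   | inj₁ o = inj₁ (direct-in w pγ o c∈ r′)
        ...   | inj₂ (a , b , fs , e , r₁ , r₂) with ∈-resp-↭ e c∈
        ...     | here refl = inj₁ (through w pγ (↭-trans e (swap a b ↭-refl)) r₂ r′)
        ...     | there (here refl) = inj₁ (through w pγ e r₁ r′)
        ...     | there (there i) with ∈⇒↭ i
        ...       | fs′ , e′ = inj₁ (through w pγ (↭-trans e (prep a (↭-trans (prep b e′) (swap b c ↭-refl)))) r₁ r′)
        turn {q} {p} w pγ rich | no ¬i | no ¬out = inj₂ (inj₂ rich′ , noOut , ¬i)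
          where
          noOut : ∀ {b} → b ∈ fam → ¬ Out p b
          noOut b∈ r = ¬out (lose b∈ r)
          p∈ = ∈-resp-↭ pγ (last∈ w)
          rich′ : ∃₂ λ a b → ∃ λ fs → fam ↭ a ∷ b ∷ fs × In p a × In p b
          rich′ with pick
          ... | a , _ , e with others (from-fam e (here refl))
          ...   | b , c , fs , e′ = a , b , c ∷ fs , e′ , in-or-out p∈ a∈ (noOut a∈) , in-or-out p∈ b∈ (noOut b∈)
            where
            a∈ = from-fam e′ (here refl)
            b∈ = from-fam e′ (there (here refl))

        Leave : Fin N → Set
        Leave x = (∃ λ j → I j x) ⊎ ∃ λ b → b ∈ fam × Out x b

        -- Opened at a rich vertex, the cycle has a rich last vertex unless it can be attached; so richness
        -- travels backwards along the cycle until it meets a vertex with an exit.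
        spin : ∀ m {s t x} K A → length A ≤ m → Walk E s t (K ++ A) → E t s → K ++ A ↭ G →
               Rich s → x ∈ A → Leave x → Cover
        spin m K A l w c pγ rich x∈ lv with turn w pγ rich
        ... | inj₁ cov = cov
        ... | inj₂ (rich′ , noOut , ¬i) with initLast A
        spin m {s} {t} {x} K .(A′ ++ y ∷ []) l w c pγ rich x∈ lv | inj₂ (rich′ , noOut , ¬i) | A′ ∷ʳ′ y
          with walk-unsnoc (K ++ A′) (subst (Walk E s t) (sym (++-assoc K A′ (y ∷ []))) w)
        ... | refl , tl with ∈-++⁻ A′ x∈
        ...   | inj₂ (here refl) = ⊥-elim (stuck lv)
          where
          stuck : ¬ Leave t
          stuck (inj₁ i)             = ¬i i
          stuck (inj₂ (b , b∈ , r)) = noOut b∈ r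
        ...   | inj₁ x∈′ with tl
        ...     | inj₁ eq = ⊥-elim (none (subst (x ∈_) eq (∈-++⁺ʳ K x∈′)))
          where
          none : ¬ (x ∈ [])
          none ()
        ...     | inj₂ (u , w′ , r) with m | ≤-trans (≤-reflexive (sym (trans (length-++ A′) (+-comm (length A′) 1)))) l
        ...       | suc m′ | s≤s l′ =
          spin m′ (y ∷ K) A′ l′ (c ▸ w′) r
            (↭-trans (∷↭∷ʳ y (K ++ A′)) (↭-trans (↭-reflexive (++-assoc K A′ (y ∷ []))) pγ)) rich′ x∈′ lv

        -- An entry served by the single thread `a` need not be rich. Its predecessor `t′` on the
        -- cycle then decides: if it leads to one of two further threads the cycle is attached at
        -- once, and otherwise both lead to `t′`, which is rich.
        cyclic : ∀ {s t γ e x} → Walk E s t γ → E t s → γ ↭ G →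
                 e ∈ G → (O e ⊎ ∃ λ a → a ∈ fam × In e a) → x ∈ G → Leave x → Cover
        cyclic w c pγ e∈ en x∈ lv with rotate-to w c (∈-resp-↭ (↭-sym pγ) e∈)
        ... | t′ , γ′ , w′ , c′ , p′ with en
        ...   | inj₁ o = spin (length γ′) [] γ′ ≤-refl w′ c′ pG (inj₁ o) (∈-resp-↭ (↭-sym pG) x∈) lv
          where pG = ↭-trans p′ pγ
        ...   | inj₂ (a , a∈ , r) with others a∈
        ...     | b , c₀ , fs , e with E? t′ (src b) | E? t′ (src c₀)
        ...       | yes r′ | _ = through w′ (↭-trans p′ pγ) e r r′
        ...       | no _ | yes r′ = through w′ (↭-trans p′ pγ) (↭-trans e (prep a (swap b c₀ ↭-refl))) r r′
        ...       | no ¬b | no ¬c with rotate-to w′ c′ (last∈ w′)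
        ...         | t″ , γ″ , w″ , c″ , p″ =
          spin (length γ″) [] γ″ ≤-refl w″ c″ pG rich (∈-resp-↭ (↭-sym pG) x∈) lv
          where
          pG = ↭-trans p″ (↭-trans p′ pγ)
          t∈ = ∈-resp-↭ (↭-trans p′ pγ) (last∈ w′)
          rich : Rich t′
          rich = inj₂ (b , c₀ , a ∷ fs , ↭-trans e (↭-trans (swap a b ↭-refl) (prep b (swap a c₀ ↭-refl))) ,
                       in-or-out t∈ (from-fam e (there (here refl))) ¬b ,
                       in-or-out t∈ (from-fam e (there (there (here refl)))) ¬c)

    module _ (O? : ∀ v → Dec (O v)) (I? : ∀ j v → Dec (I j v)) (j₀ : Fin n)
      (enter : ∀ {v} → v ∉ X → ∃₂ λ o p → O o × Walk E o v p × (∀ {u} → u ∈ p → u ∉ X))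
      (leave : ∀ {v} → v ∉ X → ∃₂ λ t p → (∃ λ j → I j t) × Walk E v t p × (∀ {u} → u ∈ p → u ∉ X)) where

      absorb : ∀ {ts} → (∀ j → 3 ≤ count j ts) → Saturated ts → Cover
      absorb three record { G = [] ; fam = fam ; perm = perm ; types≡ = refl } =
        fam , perm , λ j → count⇒∈ (≤-trans (s≤s z≤n) (three j))
      absorb three record { G = G@(g ∷ _) ; fam = fam ; perm = perm ; types≡ = refl ; blocked = blocked } =
        finish (traversal (here refl))
        where
        open Leftover {fam} three j₀ {G} perm blocked
        open Cyclic I?
        G! = proj₁ (Unique-++ G (Unique-↭ (↭-sym perm) W!))
        G∌ : ∀ {v} → v ∈ G → v ∉ X
        G∌ i = W∌ (∈-resp-↭ perm (∈-++⁺ˡ i))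
        covered : ∀ {u} → u ∉ X → u ∉ G → ∃ λ e → e ∈ fam × u ∈ vs e
        covered u∉X u∉G with ∈-++⁻ G (∈-resp-↭ (↭-sym perm) (∈W u∉X))
        ... | inj₁ i = ⊥-elim (u∉G i)
        ... | inj₂ i = concatMap-∈⁻ vs fam i
        Enter : Fin N → Set
        Enter e = O e ⊎ ∃ λ a → a ∈ fam × In e a
        -- Uses the final stretch inside `G` of a walk from `O`. A vertex just before this stretch
        -- lies on a thread, and blockedness moves its arc to the last vertex of that thread.
        entry : ∀ {h} → h ∈ G → ∃₂ λ e p → Walk E e h p × p ⊆ G × Enter e
        entry h∈ with enter (G∌ h∈)
        ... | o , p , oo , w , av with walk-entering (_∈? G) w h∈
        ...   | z , q , wq , al , inj₁ refl = z , q , wq , al , inj₁ oo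
        ...   | z , q , wq , al , inj₂ (u , u∈ , u∉G , r) with covered (av u∈) u∉G
        ...     | e , e∈ , i = z , q , wq , al , inj₂ (e , e∈ , proj₁ (blocked (al (head∈ wq)) e∈) i r)
        exit : ∀ {h} → h ∈ G → ∃₂ λ x p → Walk E h x p × p ⊆ G × Leave x
        exit h∈ with leave (G∌ h∈)
        ... | t , p , it , w , av with walk-leaving (_∈? G) w h∈
        ...   | z , q , wq , al , inj₁ refl = z , q , wq , al , inj₁ it
        ...   | z , q , wq , al , inj₂ (u , u∈ , u∉G , r) with covered (av u∈) u∉G
        ...     | e , e∈ , i = z , q , wq , al , inj₂ (e , e∈ , proj₂ (blocked (al (last∈ wq)) e∈) i r)
        open Traverse G G! Enter Leave entry exit
        finish : Traversal → Cover
        finish (path _ w pγ en ex) = finish-path w pγ en ex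
          where
          finish-path : ∀ {e x γ} → Walk E e x γ → γ ↭ G → Enter e → Leave x → Cover
          finish-path w pγ en (inj₁ i) = direct w pγ en i
          finish-path w pγ (inj₁ o) (inj₂ (b , b∈ , r)) = direct-in w pγ o b∈ r
          finish-path w pγ (inj₂ (a , a∈ , r)) (inj₂ (b , b∈ , r′)) with ∈⇒↭ a∈
          ... | fs , e with ∈-resp-↭ e b∈
          ...   | there i with ∈⇒↭ i
          ...     | fs′ , e′ = through w pγ (↭-trans e (prep a e′)) r r′
          -- Here both ends of `γ` attach to one thread, which would close up into a cycle; two
          -- further threads are brought in.
          finish-path w pγ (inj₂ (a , a∈ , r)) (inj₂ (b , b∈ , r′)) | fs , e | here refl with others a∈
          ...   | b′ , c , _ , e″ = Scan.start e″ r r′ w pγ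
        finish (cycle γ w c pγ) with entry (here refl) | exit (here refl)
        ... | e , p , wp , p⊆ , en | x , r , wr , r⊆ , ex = cyclic w c pγ (p⊆ (head∈ wp)) en (r⊆ (last∈ wr)) ex

  -- Pairs with a common start set: disjoint paths by Menger, absorption, merging.

  module Common {n : ℕ} (O : Fin N → Set) (I : Fin n → Fin N → Set) (X : List (Fin N))
    (O? : ∀ v → Dec (O v)) (I? : ∀ j v → Dec (I j v)) where

    open Absorb O I X
    open Thread
    open Count {n}

    mergeAll : ∀ j e es → type e ≡ j → (∀ {f} → f ∈ es → type f ≡ j) → Unique (vs e ++ verts es) →
               ∃ λ e′ → type e′ ≡ j × vs e′ ↭ vs e ++ verts es
    mergeAll j e []       t _ u = e , t , ↭-reflexive (sym (++-identityʳ (vs e)))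
    mergeAll j e (f ∷ es) t h u
      with merge (walk e) (walk f) (λ i k → proj₂ (proj₂ (Unique-++ (vs e) u)) i (∈-++⁺ˡ k))
    ... | a , b , r , w , pr , hd , tl
      with mergeAll j (thread j w (start hd) (end tl)) es refl (h ∘ there) (Unique-↭ (↭-sym perm) u)
      where
      start : a ≡ src e ⊎ a ≡ src f → O a
      start (inj₁ refl) = src∈ e
      start (inj₂ refl) = src∈ f
      end : b ≡ tgt e ⊎ b ≡ tgt f → I j b
      end (inj₁ refl) = subst (λ k → I k b) t (tgt∈ e)
      end (inj₂ refl) = subst (λ k → I k b) (h (here refl)) (tgt∈ f)
      perm : r ++ verts es ↭ vs e ++ vs f ++ verts es
      perm = ↭-trans (++⁺ʳ (verts es) pr) (↭-reflexive (++-assoc (vs e) (vs f) (verts es)))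
    ... | e′ , t′ , p′ = e′ , t′ , ↭-trans p′
        (↭-trans (++⁺ʳ (verts es) pr) (↭-reflexive (++-assoc (vs e) (vs f) (verts es))))

    gather : Cover → Linkage E X (λ _ → O) I
    gather (fam , perm , all) = record
      { vs = λ j → vs (T j) ; src = λ j → src (T j) ; tgt = λ j → tgt (T j)
      ; walk = λ j → walk (T j) ; src∈ = λ j → src∈ (T j)
      ; tgt∈ = λ j → subst (λ k → I k (tgt (T j))) (T-type j) (tgt∈ (T j))
      ; vs! = λ j → Unique-↭ (↭-sym (T-perm j)) (class! j)
      ; disjoint = disj
      ; avoid = λ {j} i → W∌ (∈-resp-↭ perm (proj₁ (class⊆ j (∈-resp-↭ (T-perm j) i))))
      ; cover = cov
      }
      where
      fam! : Unique (verts fam)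
      fam! = Unique-↭ (↭-sym perm) W!
      class : Fin n → List Thread
      class j = filter (λ e → type e ≟ j) fam
      class! : ∀ j → Unique (verts (class j))
      class! j = proj₁ (Unique-++ (verts (class j)) (subst Unique (concatMap-++ vs (class j) _)
        (Unique-↭ (↭-sym (concatMap-↭ vs (filter-split (λ e → type e ≟ j) fam))) fam!)))
      class⊆ : ∀ j {v} → v ∈ verts (class j) → v ∈ verts fam × ∃ λ e → e ∈ fam × v ∈ vs e × type e ≡ j
      class⊆ j i with concatMap-∈⁻ vs (class j) i
      ... | e , e∈ , k with ∈-filter⁻ (λ e → type e ≟ j) {xs = fam} e∈
      ...   | e∈′ , t = concatMap-∈⁺ vs e∈′ k , e , e∈′ , k , t
      merged : ∀ j → ∃ λ e′ → type e′ ≡ j × vs e′ ↭ verts (class j)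
      merged j with ∈-map⁻ type (all j)
      ... | e , e∈ , eq = go (class j) (∈-filter⁺ (λ e → type e ≟ j) e∈ (sym eq)) (class! j)
            (λ i → proj₂ (∈-filter⁻ (λ e → type e ≟ j) {xs = fam} i))
        where
        go : ∀ es → e ∈ es → Unique (verts es) → (∀ {f} → f ∈ es → type f ≡ j) →
             ∃ λ e′ → type e′ ≡ j × vs e′ ↭ verts es
        go (f ∷ es) _ u h = mergeAll j f es (h (here refl)) (h ∘ there) u
      T : Fin n → Thread
      T j = proj₁ (merged j)
      T-type : ∀ j → type (T j) ≡ j
      T-type j = proj₁ (proj₂ (merged j))
      T-perm : ∀ j → vs (T j) ↭ verts (class j)
      T-perm j = proj₂ (proj₂ (merged j))
      disj : ∀ {i j v} → v ∈ vs (T i) → v ∈ vs (T j) → i ≡ j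
      disj {i} {j} p q with class⊆ i (∈-resp-↭ (T-perm i) p) | class⊆ j (∈-resp-↭ (T-perm j) q)
      ... | _ , e , e∈ , v∈e , te | _ , f , f∈ , v∈f , tf with unique-owner vs fam! e∈ f∈ v∈e v∈f
      ...   | refl = trans (sym te) tf
      cov : ∀ {v} → v ∉ X → ∃ λ j → v ∈ vs (T j)
      cov v∉ with concatMap-∈⁻ vs fam (∈-resp-↭ (↭-sym perm) (∈W v∉))
      ... | e , e∈ , v∈ = type e , ∈-resp-↭ (↭-sym (T-perm (type e)))
              (concatMap-∈⁺ vs (∈-filter⁺ (λ f → type f ≟ type e) e∈ refl) v∈)

    -- Three sinks for every type; a walk may leave the tournament into a sink of type j from I j.
    Node : Set
    Node = Fin N ⊎ Fin (n * 3)

    kind : Fin (n * 3) → Fin n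
    kind s = proj₁ (remQuot 3 s)

    _≟ₙ_ : (a b : Node) → Dec (a ≡ b)
    _≟ₙ_ = ≡-dec _≟_ _≟_

    arcs₁ arcs₂ arcs : List (Node × Node)
    arcs₁ = map (λ (u , v) → inj₁ u , inj₁ v) (filter (λ (u , v) → E? u v) (cartesianProduct W W))
    arcs₂ = map (λ (u , s) → inj₁ u , inj₂ s) (filter (λ (u , s) → I? (kind s) u) (cartesianProduct W (allFin (n * 3))))
    arcs  = arcs₁ ++ arcs₂

    sources sinks : List Node
    sources = map inj₁ (filter O? W)
    sinks   = map inj₂ (allFin (n * 3))

    arc₁ : ∀ {u v} → u ∉ X → v ∉ X → E u v → (inj₁ u , inj₁ v) ∈ arcs
    arc₁ u∉ v∉ e = ∈-++⁺ˡ (∈-map⁺ _ (∈-filter⁺ (λ (u , v) → E? u v) (∈-cartesianProduct⁺ (∈W u∉) (∈W v∉)) e))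

    arc₂ : ∀ {u s} → u ∉ X → I (kind s) u → (inj₁ u , inj₂ s) ∈ arcs
    arc₂ {s = s} u∉ i =
      ∈-++⁺ʳ arcs₁ (∈-map⁺ _ (∈-filter⁺ (λ (u , s) → I? (kind s) u) (∈-cartesianProduct⁺ (∈W u∉) (∈-allFin s)) i))

    data IsArc : Node → Node → Set where
      inner : ∀ {u v} → E u v → u ∈ W → IsArc (inj₁ u) (inj₁ v)
      outer : ∀ {u s} → I (kind s) u → u ∈ W → IsArc (inj₁ u) (inj₂ s)

    isArc : ∀ {a b} → (a , b) ∈ arcs → IsArc a b
    isArc i with ∈-++⁻ arcs₁ i
    ... | inj₁ j with ∈-map⁻ _ j
    ...   | (u , v) , k , refl with ∈-filter⁻ (λ (u , v) → E? u v) {xs = cartesianProduct W W} k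
    ...     | m , e = inner e (proj₁ (∈-cartesianProduct⁻ W W m))
    isArc i | inj₂ j with ∈-map⁻ _ j
    ...   | (u , s) , k , refl with ∈-filter⁻ (λ (u , s) → I? (kind s) u) {xs = cartesianProduct W (allFin (n * 3))} k
    ...     | m , e = outer e (proj₁ (∈-cartesianProduct⁻ W (allFin (n * 3)) m))

    -- No arc leaves a sink, so everything before the last node lies in the tournament.
    trace : ∀ {u s p} → Walk (Arc _≟ₙ_ arcs) (inj₁ u) (inj₂ s) p →
            ∃₂ λ v q → p ≡ map inj₁ q ++ inj₂ s ∷ [] × Walk E u v q × I (kind s) v × q ⊆ W
    trace (e ▸ w) with isArc e
    trace (e ▸ w) | inner r u∈ with trace w
    ... | v , q , refl , w′ , i , q⊆ = v , _ , refl , r ▸ w′ , i , λ { (here refl) → u∈ ; (there k) → q⊆ k }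
    trace (e ▸ stop _) | outer i u∈ = _ , _ , refl , stop _ , i , λ { (here refl) → u∈ }
    trace (e ▸ e′ ▸ _) | outer i u∈ with isArc e′
    ... | ()

    L : Set
    L = Link _≟ₙ_ arcs sources sinks

    -- Each thread keeps its sink beside it: the sinks used are distinct, which later yields three
    -- threads of every type.
    threads : (ls : List L) → Σ[ ts ∈ List (Thread × Fin (n * 3)) ]
      map (Link.tgt) ls ≡ map (inj₂ ∘ proj₂) ts × (∀ {t s} → (t , s) ∈ ts → type t ≡ kind s) ×
      (∀ {t s} → (t , s) ∈ ts → vs t ⊆ W) ×
      concatMap Link.vs ls ↭ map inj₁ (concatMap (vs ∘ proj₁) ts) ++ map (inj₂ ∘ proj₂) ts
    threads [] = [] , refl , (λ ()) , (λ ()) , ↭-refl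
    threads (link w s∈ t∈ ∷ ls) with ∈-map⁻ inj₁ s∈ | ∈-map⁻ inj₂ t∈ | threads ls
    ... | o , o∈ , refl | s , _ , refl | ts , eq , ty , sub , perm with trace w
    ... | v , q , refl , w′ , i , q⊆ =
      (thread (kind s) w′ (proj₂ (∈-filter⁻ O? {xs = W} o∈)) i , s) ∷ ts ,
      cong (inj₂ s ∷_) eq ,
      (λ { (here refl) → refl ; (there k) → ty k }) ,
      (λ { (here refl) → q⊆ ; (there k) → sub k }) ,
      ↭-trans (++⁺ˡ (map inj₁ q ++ inj₂ s ∷ []) perm)
        (↭-trans (++-interchange (map inj₁ q) (inj₂ s ∷ []) (map inj₁ (concatMap (vs ∘ proj₁) ts))
            (map (inj₂ ∘ proj₂) ts))
          (++⁺ʳ _ (↭-reflexive (sym (map-++ inj₁ q (concatMap (vs ∘ proj₁) ts))))))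

    module _ (j₀ : Fin n) (good : Good E (n * 3) X O) (cogood : ∀ j → Good (flip E) (n * 3) X (I j)) where

      -- Fewer than `n * 3` nodes miss some sink `s`. Goodness on the end side gives a vertex of
      -- `I (kind s)` outside the separator, and goodness on the start side a walk to it from `O`;
      -- extended to `s`, this walk avoids `S`.
      inseparable : ∀ S → length S < n * 3 → ¬ Separates _≟ₙ_ arcs sources sinks S
      inseparable S l sep with all? (λ s → Any.any? (inj₂ s ≟ₙ_) S) (allFin (n * 3))
      ... | yes al = n≮n _ (≤-<-trans (≤-trans (≤-reflexive (sym len)) (Unique⇒length≤ sinks! sub)) l)
        where
        sinks! : Unique sinks
        sinks! = Uniqueₚ.map⁺ inj₂-injective (Uniqueₚ.allFin⁺ (n * 3))
        len : length sinks ≡ n * 3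
        len = trans (length-map inj₂ (allFin (n * 3))) (length-tabulate id)
        sub : sinks ⊆ S
        sub i with ∈-map⁻ inj₂ i
        ... | s , s∈ , refl = lookup al s∈
      ... | no ¬al with find (¬All⇒Any¬ (λ s → Any.any? (inj₂ s ≟ₙ_) S) _ ¬al)
      ... | s , _ , s∉ with ≤-<-trans (length-lefts S) l
      ... | l′ with Good.some (cogood (kind s)) (lefts S) l′
      ... | v , iv , v∉ with Good.reach good (lefts S) l′ v∉
      ... | o , p , oo , w , av with sep (link (lift w av iv) (∈-map⁺ inj₁ (∈-filter⁺ O? (∈W (av′ (head∈ w))) oo))
          (∈-map⁺ inj₂ (∈-allFin s)))
        where
        av′ : ∀ {u} → u ∈ p → u ∉ X
        av′ i = av i ∘ ∈-++⁺ʳ (lefts S)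
        lift : ∀ {u v p} → Walk E u v p → (∀ {u} → u ∈ p → u ∉ lefts S ++ X) → I (kind s) v →
               Walk (Arc _≟ₙ_ arcs) (inj₁ u) (inj₂ s) (map inj₁ p ++ inj₂ s ∷ [])
        lift (stop u) a i = arc₂ (a (here refl) ∘ ∈-++⁺ʳ (lefts S)) i ▸ stop (inj₂ s)
        lift (e ▸ w)  a i = arc₁ (a (here refl) ∘ ∈-++⁺ʳ (lefts S))
            (a (there (head∈ w)) ∘ ∈-++⁺ʳ (lefts S)) e ▸ lift w (a ∘ there) i
      ... | z , z∈S , z∈p with ∈-++⁻ (map inj₁ p) z∈p
      ...   | inj₂ (here refl) = s∉ z∈S
      ...   | inj₁ i with ∈-map⁻ inj₁ i
      ...     | u , u∈ , refl = av u∈ (∈-++⁺ˡ (∈-lefts z∈S))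

      nonzero : 0 < n * 3
      nonzero = positive j₀
        where
        positive : ∀ {m} → Fin m → 0 < m * 3
        positive {suc _} _ = s≤s z≤n

      initial : ∃₂ λ G fam → G ++ verts fam ↭ W × (∀ j → 3 ≤ count j (types fam))
      initial with menger _≟ₙ_ arcs sources sinks (n * 3)
      ... | inj₂ (S , l , sep) = ⊥-elim (inseparable S l sep)
      ... | inj₁ (ls , len , u) with threads ls
      ... | ts , eq , ty , sub , perm = proj₁ comp , fam , ↭-trans (++-comm (proj₁ comp) (verts fam))
          (proj₂ comp) , three
        where
        fam  = map proj₁ ts
        keys = map proj₂ ts
        split = Unique-++ (map inj₁ (concatMap (vs ∘ proj₁) ts)) (Unique-↭ perm u)
        verts≡ : ∀ (ts : List (Thread × Fin (n * 3))) → concatMap (vs ∘ proj₁) ts ≡ verts (map proj₁ ts)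
        verts≡ []       = refl
        verts≡ (t ∷ ts) = cong (vs (proj₁ t) ++_) (verts≡ ts)
        fam! : Unique (verts fam)
        fam! = subst Unique (verts≡ ts) (Uniqueₚ.map⁻ (proj₁ split))
        fam⊆ : verts fam ⊆ W
        fam⊆ i with concatMap-∈⁻ (vs ∘ proj₁) ts (subst (_ ∈_) (sym (verts≡ ts)) i)
        ... | (t , s) , t∈ , k = sub t∈ k
        comp = complement fam! fam⊆
        keys! : Unique keys
        keys! = Uniqueₚ.map⁻ (subst Unique (map-∘ ts) (proj₁ (proj₂ split)))
        keys-len : length keys ≡ n * 3
        keys-len = trans (length-map proj₂ ts) (trans (sym (length-map (inj₂ ∘ proj₂) ts))
                     (trans (cong length (sym eq)) (trans (length-map Link.tgt ls) len)))
        keys-all : keys ↭ allFin (n * 3)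
        keys-all = Unique⇒↭ keys! (λ _ → ∈-allFin _)
          (≤-reflexive (trans (length-tabulate {n = n * 3} id) (sym keys-len)))
        count≡ : ∀ j (ts : List (Thread × Fin (n * 3))) → (∀ {t s} → (t , s) ∈ ts → type t ≡ kind s) →
                 length (filter (λ s → kind s ≟ j) (map proj₂ ts)) ≡ count j (types (map proj₁ ts))
        count≡ j []             _ = refl
        count≡ j ((t , s) ∷ ts) h with type t | h (here refl)
        ... | _ | refl with kind s ≟ j
        ...   | yes _ = cong suc (count≡ j ts (h ∘ there))
        ...   | no  _ = count≡ j ts (h ∘ there)
        -- There are as many links as sinks, so every sink is used, among them `combine j c` for the
        -- three values of `c`.
        three : ∀ j → 3 ≤ count j (types fam)
        three j = ≤-trans (Unique⇒length≤ {xs = xs} xs! xs⊆) (≤-reflexive (count≡ j ts ty))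
          where
          xs = map (combine j) (allFin 3)
          xs! : Unique xs
          xs! = Uniqueₚ.map⁺ (λ {c} {c′} → combine-injectiveʳ j c j c′) (Uniqueₚ.allFin⁺ 3)
          xs⊆ : xs ⊆ filter (λ s → kind s ≟ j) keys
          xs⊆ i with ∈-map⁻ (combine j) i
          ... | c , _ , refl = ∈-filter⁺ (λ s → kind s ≟ j) (∈-resp-↭ (↭-sym keys-all) (∈-allFin _))
                                 (cong proj₁ (remQuot-combine j c))

      parallel : Linkage E X (λ _ → O) I
      parallel with initial
      ... | G , fam , perm , three =
        gather (absorb O? I? j₀ enter leave three (saturate (length G) G fam ≤-refl perm))
        where
        enter : ∀ {v} → v ∉ X → ∃₂ λ o p → O o × Walk E o v p × (∀ {u} → u ∈ p → u ∉ X)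
        enter = Good.reach good [] nonzero
        leave : ∀ {v} → v ∉ X → ∃₂ λ t p → (∃ λ j → I j t) × Walk E v t p × (∀ {u} → u ∈ p → u ∉ X)
        leave v∉ with Good.reach (cogood j₀) [] nonzero v∉
        ... | t , p , it , w , av = t , reverse p , (j₀ , it) , walk-reverse w , av ∘ AnyP.reverse⁻

  -- Shortest paths between two sets, and goodness after deleting one.

  near? : ∀ X {O} → (∀ v → Dec (O v)) → ∀ u → Dec (Near E X O u)
  near? X O? u = O? u ⊎-dec
    (any? (λ o → (O? o ×-dec ¬? (o ∈? X)) ×-dec E? o u) ⊎-dec
     any? (λ o → (O? o ×-dec ¬? (o ∈? X)) ×-dec any? (λ w → ¬? (w ∈? X) ×-dec E? o w ×-dec E? w u)))

  module _ (X : List (Fin N)) {O I : Fin N → Set} (O? : ∀ v → Dec (O v)) (I? : ∀ v → Dec (I v)) where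

    private
      -- Records a walk with exactly this many arcs that ends in `I` and avoids `X`. Fixing the
      -- length makes existence decidable, as the search for a least length requires.
      To : ℕ → Fin N → Set
      To zero    v = I v × v ∉ X
      To (suc n) v = v ∉ X × ∃ λ u → E v u × To n u

      to? : ∀ n v → Dec (To n v)
      to? zero    v = I? v ×-dec ¬? (v ∈? X)
      to? (suc n) v = ¬? (v ∈? X) ×-dec any? (λ u → E? v u ×-dec to? n u)

      measured : ∀ {s t p} → Walk E s t p → I t → (∀ {u} → u ∈ p → u ∉ X) → ∃ λ n → length p ≡ suc n × To n s
      measured (stop s) i av = 0 , refl , i , av (here refl)
      measured (e ▸ w)  i av with measured w i (av ∘ there)
      ... | n , l , to = suc n , cong suc l , av (here refl) , _ , e , to

      rebuild : ∀ n {s} → To n s → ∃₂ λ t p → Walk E s t p × I t × (∀ {u} → u ∈ p → u ∉ X) × length p ≡ suc n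
      rebuild zero    (i , s∉) = _ , _ , stop _ , i , (λ { (here refl) → s∉ }) , refl
      rebuild (suc n) (s∉ , u , e , to) with rebuild n to
      ... | t , p , w , i , av , l = t , _ , e ▸ w , i , (λ { (here refl) → s∉ ; (there k) → av k }) , cong suc l

    shortest : ∀ {s t p} → Walk E s t p → O s → I t → (∀ {u} → u ∈ p → u ∉ X) → Shortest E X O I
    shortest {s₀} w₀ os₀ it₀ av₀ with measured w₀ it₀ av₀
    ... | n , _ , to₀ with least (λ n → any? (λ v → O? v ×-dec to? n v)) n (s₀ , os₀ , to₀)
    ... | m , (s , os , to) , min with rebuild m to
    ... | t , p , w , it , av , l = record
      { walk = w ; src∈ = os ; tgt∈ = it ; avoid = av
      ; minimal = λ w′ os′ it′ av′ → let n′ , l′ , to′ = measured w′ it′ av′ in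
          ≤-trans (≤-reflexive l) (≤-trans (s≤s (≮⇒≥ λ n′<m → min n′ n′<m (_ , os′ , to′))) (≤-reflexive (sym l′))) }

  record Closure (Z : List (Fin N)) (O : Fin N → Set) : Set where
    field
      B       : List (Fin N)
      reached : ∀ {b} → b ∈ B → ∃₂ λ o p → O o × Walk E o b p × (∀ {u} → u ∈ p → u ∉ Z)
      start   : ∀ {o} → O o → o ∉ Z → o ∈ B
      closed  : ∀ {b v} → b ∈ B → v ∉ Z → E b v → v ∈ B

  closure : ∀ Z {O} → (∀ v → Dec (O v)) → Closure Z O
  closure Z {O} O? = go (length remaining) B₀ remaining ≤-refl
    (λ b∈ → let _ , ob , b∉ = ∈-filter⁻ start? {xs = allFin N} b∈ in _ , _ , ob , stop _ , λ { (here refl) → b∉ })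
    (λ oo o∉ → ∈-filter⁺ start? (∈-allFin _) (oo , o∉))
    (λ v∉ → inj₂ (∈-filter⁺ (λ v → ¬? (v ∈? Z)) (∈-allFin _) v∉))
    where
    start? : ∀ v → Dec (O v × v ∉ Z)
    start? v = O? v ×-dec ¬? (v ∈? Z)
    B₀ remaining : List (Fin N)
    B₀ = filter start? (allFin N)
    remaining = filter (λ v → ¬? (v ∈? Z)) (allFin N)
    Reached : Fin N → Set
    Reached b = ∃₂ λ o p → O o × Walk E o b p × (∀ {u} → u ∈ p → u ∉ Z)
    go : ∀ n B R → length R ≤ n → (∀ {b} → b ∈ B → Reached b) → (∀ {o} → O o → o ∉ Z → o ∈ B) →
         (∀ {v} → v ∉ Z → v ∈ B ⊎ v ∈ R) → Closure Z O
    go n B R l re st spl with Any.any? (λ v → ¬? (v ∈? Z) ×-dec Any.any? (λ b → E? b v) B) R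
    ... | no ¬more = record { B = B ; reached = re ; start = st ; closed = cl }
      where
      cl : ∀ {b v} → b ∈ B → v ∉ Z → E b v → v ∈ B
      cl b∈ v∉ e with spl v∉
      ... | inj₁ v∈B = v∈B
      ... | inj₂ v∈R = ⊥-elim (¬more (lose v∈R (v∉ , lose b∈ e)))
    ... | yes more with find more
    ... | v , v∈R , v∉Z , some-b with find some-b | ∈⇒↭ v∈R
    ... | b , b∈ , e | R′ , pR with n | ≤-trans (≤-reflexive (sym (↭-length pR))) l
    ... | suc n′ | s≤s l′ = go n′ (v ∷ B) R′ l′ re′ (λ oo o∉ → there (st oo o∉)) spl′
      where
      re′ : ∀ {c} → c ∈ v ∷ B → Reached c
      re′ (there i) = re i
      re′ (here refl) with re b∈
      ... | o , p , oo , w , av = o , _ , oo , walk-++ w e (stop v) , av′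
        where
        av′ : ∀ {u} → u ∈ p ++ v ∷ [] → u ∉ Z
        av′ i with ∈-++⁻ p i
        ... | inj₁ j           = av j
        ... | inj₂ (here refl) = v∉Z
      spl′ : ∀ {u} → u ∉ Z → u ∈ v ∷ B ⊎ u ∈ R′
      spl′ u∉ with spl u∉
      ... | inj₁ i = inj₁ (there i)
      ... | inj₂ i with ∈-resp-↭ pR i
      ...   | here refl = inj₁ (here refl)
      ...   | there j   = inj₂ j

  module _ {X : List (Fin N)} {O I : Fin N → Set} (P : Shortest E X O I) where

    open Shortest P

    private
      too-short : ∀ {s t q} → Walk E s t q → O s → I t → (∀ {u} → u ∈ q → u ∉ X) → ¬ length q < length vs
      too-short w o i av l = n≮n _ (<-≤-trans l (minimal w o i av))

      suffix : ∀ l {u r} → vs ≡ l ++ u ∷ r → Walk E u tgt (u ∷ r)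
      suffix l eq = walk-suffix l (subst (Walk E src tgt) eq walk)

      prefix : ∀ l {u r} → vs ≡ l ++ u ∷ r → Walk E src u (l ++ u ∷ [])
      prefix l eq = walk-prefix l (subst (Walk E src tgt) eq walk)

      len : ∀ l {u r} → vs ≡ l ++ u ∷ r → length vs ≡ length l + suc (length r)
      len l eq = trans (cong length eq) (length-++ l)

      suffix-avoid : ∀ l {u r} → vs ≡ l ++ u ∷ r → ∀ {v} → v ∈ u ∷ r → v ∉ X
      suffix-avoid l eq i = avoid (subst (_ ∈_) (sym eq) (∈-++⁺ʳ l i))

      prefix-avoid : ∀ l {u r} → vs ≡ l ++ u ∷ r → ∀ {v} → v ∈ l ++ u ∷ [] → v ∉ X
      prefix-avoid l eq i with ∈-++⁻ l i
      ... | inj₁ j           = avoid (subst (_ ∈_) (sym eq) (∈-++⁺ˡ j))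
      ... | inj₂ (here refl) = suffix-avoid l eq (here refl)

    -- A route of at most two arcs from `O` puts at most two vertices before `u`, where the shortest
    -- path has three.
    near-early : ∀ l {u r} → vs ≡ l ++ u ∷ r → 3 ≤ length l → ¬ Near E X O u
    near-early l {u} {r} eq l≥3 near = go near
      where
      shorter : ∀ {k} → k < 3 → k + suc (length r) < length vs
      shorter {k} k<3 = <-≤-trans (+-monoˡ-< (suc (length r)) k<3)
        (≤-trans (+-monoˡ-≤ (suc (length r)) l≥3) (≤-reflexive (sym (len l eq))))
      w = suffix l eq
      av = suffix-avoid l eq
      go : ¬ Near E X O u
      go (inj₁ o) = too-short w o tgt∈ av (shorter {0} (s≤s z≤n))
      go (inj₂ (inj₁ (o , (oo , o∉) , e))) =
        too-short (e ▸ w) oo tgt∈ (λ { (here refl) → o∉ ; (there i) → av i }) (shorter {1} (s≤s (s≤s z≤n)))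
      go (inj₂ (inj₂ (o , (oo , o∉) , z , z∉ , e , e′))) =
        too-short (e ▸ e′ ▸ w) oo tgt∈ (λ { (here refl) → o∉ ; (there (here refl)) → z∉ ; (there (there i)) → av i })
          (shorter {2} (s≤s (s≤s (s≤s z≤n))))

    no-shortcut : ∀ a {u m v r} → vs ≡ a ++ u ∷ m ++ v ∷ r → 1 ≤ length m → ¬ E u v
    no-shortcut a {u} {m} {v} {r} eq m≥1 e =
      too-short (walk-++ (prefix a eq) e (suffix (a ++ u ∷ m) eq′)) src∈ tgt∈ av short
      where
      eq′ : vs ≡ (a ++ u ∷ m) ++ v ∷ r
      eq′ = trans eq (sym (++-assoc a (u ∷ m) (v ∷ r)))
      av : ∀ {x} → x ∈ (a ++ u ∷ []) ++ v ∷ r → x ∉ X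
      av i with ∈-++⁻ (a ++ u ∷ []) i
      ... | inj₁ j = prefix-avoid a eq j
      ... | inj₂ j = suffix-avoid (a ++ u ∷ m) eq′ j
      short : length ((a ++ u ∷ []) ++ v ∷ r) < length vs
      short = <-≤-trans (≤-<-trans (≤-reflexive
          (trans (length-++ (a ++ u ∷ [])) (cong (_+ suc (length r)) (length-++ a))))
                (+-monoˡ-< (suc (length r)) (+-monoʳ-< (length a) (s≤s m≥1))))
              (≤-reflexive (sym (trans (len (a ++ u ∷ m) eq′) (cong (_+ suc (length r)) (length-++ a)))))

    -- The two new vertices `x`, `y` would replace at least three.
    no-detour : ∀ a {u m v r} → vs ≡ a ++ u ∷ m ++ v ∷ r → 3 ≤ length m →
                ∀ {x y} → x ∉ X → y ∉ X → E u x → E x y → ¬ E y v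
    no-detour a {u} {m} {v} {r} eq m≥3 {x} {y} x∉ y∉ e₁ e₂ e₃ =
      too-short (walk-++ (prefix a eq) e₁ (e₂ ▸ e₃ ▸ suffix (a ++ u ∷ m) eq′)) src∈ tgt∈ av short
      where
      eq′ : vs ≡ (a ++ u ∷ m) ++ v ∷ r
      eq′ = trans eq (sym (++-assoc a (u ∷ m) (v ∷ r)))
      av : ∀ {z} → z ∈ (a ++ u ∷ []) ++ x ∷ y ∷ v ∷ r → z ∉ X
      av i with ∈-++⁻ (a ++ u ∷ []) i
      ... | inj₁ j                   = prefix-avoid a eq j
      ... | inj₂ (here refl)         = x∉
      ... | inj₂ (there (here refl)) = y∉
      ... | inj₂ (there (there j))   = suffix-avoid (a ++ u ∷ m) eq′ j
      short : length ((a ++ u ∷ []) ++ x ∷ y ∷ v ∷ r) < length vs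
      short = <-≤-trans
        (≤-<-trans (≤-reflexive (trans (length-++ (a ++ u ∷ []))
            (trans (cong (_+ (3 + length r)) (length-++ a)) (shift2 (length a) (length r)))))
          (+-monoˡ-< (suc (length r)) (+-monoʳ-< (length a) (s≤s m≥3))))
        (≤-reflexive (sym (trans (len (a ++ u ∷ m) eq′) (cong (_+ suc (length r)) (length-++ a)))))
        where
        shift2 : ∀ p q → (p + 1) + (3 + q) ≡ (p + 3) + suc q
        shift2 = solve-∀

    -- The first vertex of P with an arc to the part Lost is the head of rest; its first
    -- four vertices cut B off from Lost.
    geodesic-good : ∀ {h h′ O′} → (∀ v → Dec (O′ v)) → 4 + h′ ≤ h → Good E h X O′ →
                    (∀ {u} → O′ u → u ∉ X → Near E X O u) → Good E h′ (vs ++ X) O′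
    geodesic-good {h} {h′} {O′} O′? le good near = record { some = some ; reach = reach }
      where
      assoc : ∀ S (F : List (Fin N)) → F ⊆ vs → (S ++ F) ++ X ⊆ S ++ vs ++ X
      assoc S F F⊆ i with ∈-++⁻ (S ++ F) i
      ... | inj₂ j = ∈-++⁺ʳ S (∈-++⁺ʳ vs j)
      ... | inj₁ j with ∈-++⁻ S j
      ...   | inj₁ k = ∈-++⁺ˡ k
      ...   | inj₂ k = ∈-++⁺ʳ S (∈-++⁺ˡ (F⊆ k))

      fits : ∀ S (F : List (Fin N)) → length F ≤ 4 → length S < h′ → length (S ++ F) < h
      fits S F l lS = <-≤-trans (≤-<-trans (≤-trans (≤-reflexive (length-++ S))
          (≤-trans (+-monoʳ-≤ (length S) l) (≤-reflexive (+-comm (length S) 4))))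
                        (+-monoʳ-< 4 lS)) le

      ∉-weaken : ∀ S (F : List (Fin N)) {v} → v ∉ (S ++ F) ++ X → v ∉ vs → v ∉ S ++ vs ++ X
      ∉-weaken S F v∉ v∉vs i with ∈-++⁻ S i
      ... | inj₁ j = v∉ (∈-++⁺ˡ (∈-++⁺ˡ j))
      ... | inj₂ j with ∈-++⁻ vs j
      ...   | inj₁ k = v∉vs k
      ...   | inj₂ k = v∉ (∈-++⁺ʳ (S ++ F) k)

      some : ∀ S → length S < h′ → ∃ λ o → O′ o × o ∉ S ++ vs ++ X
      -- Deleting the first three vertices acts like deleting the whole path: a vertex of `O′`
      -- further along it would be near `O`, against `near-early`.
      some S l with Good.some good (S ++ take 3 vs) (fits S (take 3 vs) (≤-trans (length-take-≤ 3 vs) (n≤1+n 3)) l)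
      ... | o , oo , o∉ = o , oo , ∉-weaken S (take 3 vs) o∉ late
        where
        late : o ∉ vs
        late i with ∈-take 3 i
        ... | inj₁ j = o∉ (∈-++⁺ˡ (∈-++⁺ʳ S j))
        ... | inj₂ (ys , zs , eq , l3) = near-early ys eq l3 (near oo (o∉ ∘ ∈-++⁺ʳ (S ++ take 3 vs)))

      reach : ∀ S → length S < h′ → ∀ {v} → v ∉ S ++ vs ++ X →
              ∃₂ λ o p → O′ o × Walk E o v p × (∀ {u} → u ∈ p → u ∉ S ++ vs ++ X)
      reach S l {v} v∉ with v ∈? Closure.B cl
        where cl = closure (S ++ vs ++ X) O′?
      ... | yes v∈B = Closure.reached (closure (S ++ vs ++ X) O′?) v∈B
      ... | no v∉B = ⊥-elim contradiction
        where
        Z = S ++ vs ++ X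
        open Closure (closure Z O′?)
        Lost : Fin N → Set
        Lost a = a ∉ B × a ∉ Z
        ToLost : Fin N → Set
        ToLost u = ∃ λ a → Lost a × E u a
        ToLost? : ∀ u → Dec (ToLost u)
        ToLost? u = any? (λ a → (¬? (a ∈? B) ×-dec ¬? (a ∈? Z)) ×-dec E? u a)
        B∌ : ∀ {b} → b ∈ B → b ∉ Z
        B∌ b∈ with reached b∈
        ... | _ , _ , _ , w , av = av (last∈ w)
        break : ∀ (p : List (Fin N)) → ∃₂ λ pre rest → p ≡ pre ++ rest × (∀ {u} → u ∈ pre → ¬ ToLost u) ×
                (rest ≡ [] ⊎ ∃₂ λ w r → rest ≡ w ∷ r × ToLost w)
        break [] = [] , [] , refl , (λ ()) , inj₁ refl
        break (x ∷ p) with ToLost? x | break p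
        ... | yes t | _ = [] , x ∷ p , refl , (λ ()) , inj₂ (x , p , refl , t)
        ... | no ¬t | pre , rest , refl , n , r = x ∷ pre , rest , refl , (λ { (here refl) → ¬t ; (there i) → n i }) , r
        contradiction : ⊥
        contradiction with break vs
        ... | pre , rest , eq , noLost , hd = final
          where
          F = take 4 rest
          F⊆ : F ⊆ vs
          F⊆ i = subst (_ ∈_) (sym eq) (∈-++⁺ʳ pre (take-⊆ 4 rest i))
          -- With only `F` deleted in place of the whole path, a walk still runs from `O′` to `v`.
          -- It starts in `Side` and ends outside, so it suffices to rule out an arc leaving `Side`.
          Side : Fin N → Set
          Side u = u ∈ B ⊎ u ∈ pre
          side? : ∀ u → Dec (Side u)
          side? u = (u ∈? B) ⊎-dec (u ∈? pre)
          ¬side : ¬ Side v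
          ¬side (inj₁ i) = v∉B i
          ¬side (inj₂ i) = v∉ (∈-++⁺ʳ S (∈-++⁺ˡ (subst (v ∈_) (sym eq) (∈-++⁺ˡ i))))
          beyond-F : ∀ {x} → x ∈ vs → x ∉ pre → x ∉ F → ∃₂ λ ys zs → rest ≡ ys ++ x ∷ zs × 4 ≤ length ys
          beyond-F x∈ x∉pre x∉F with ∈-++⁻ pre (subst (_ ∈_) eq x∈)
          ... | inj₁ i = ⊥-elim (x∉pre i)
          ... | inj₂ i with ∈-take 4 i
          ...   | inj₁ j = ⊥-elim (x∉F j)
          ...   | inj₂ r = r
          start-side : ∀ {o} → O′ o → o ∉ (S ++ F) ++ X → Side o
          start-side {o} oo o∉ with o ∈? pre | o ∈? vs
          ... | yes i | _ = inj₂ i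
          ... | no _ | no o∉vs = inj₁ (start oo (∉-weaken S F o∉ o∉vs))
          ... | no ¬i | yes o∈ with beyond-F o∈ ¬i (λ j → o∉ (∈-++⁺ˡ (∈-++⁺ʳ S j)))
          ...   | ys , zs , req , l4 = ⊥-elim (near-early (pre ++ ys)
                    (trans eq (trans (cong (pre ++_) req) (sym (++-assoc pre ys (o ∷ zs)))))
                    (≤-trans (≤-trans (n≤1+n 3) l4) (≤-trans (m≤n+m (length ys) (length pre))
                        (≤-reflexive (sym (length-++ pre)))))
                    (near oo (o∉ ∘ ∈-++⁺ʳ (S ++ F))))
          step : ∀ {x y} → Side x → ¬ Side y → y ∉ (S ++ F) ++ X → ¬ E x y
          step {x} {y} sx ¬sy y∉ e with y ∈? vs
          step (inj₁ x∈B) ¬sy y∉ e | no y∉vs = ¬sy (inj₁ (closed x∈B (∉-weaken S F y∉ y∉vs) e))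
          step {x} {y} (inj₂ x∈) ¬sy y∉ e | no y∉vs = noLost x∈ (y , (¬sy ∘ inj₁ , ∉-weaken S F y∉ y∉vs) , e)
          ... | yes y∈vs with beyond-F y∈vs (¬sy ∘ inj₂) (λ j → y∉ (∈-++⁺ˡ (∈-++⁺ʳ S j)))
          step {x} {y} (inj₂ x∈) ¬sy y∉ e | yes _ | ys , zs , req , l4 with ∈-∃++ x∈
          ... | l₁ , l₂ , preq = no-shortcut l₁ {m = l₂ ++ ys}
                  (trans eq (trans (cong₂ _++_ preq req)
                    (trans (++-assoc l₁ (x ∷ l₂) (ys ++ y ∷ zs))
                        (cong (λ z → l₁ ++ x ∷ z) (sym (++-assoc l₂ ys (y ∷ zs)))))))
                  (≤-trans (≤-trans (s≤s z≤n) l4)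
                      (≤-trans (m≤n+m (length ys) (length l₂)) (≤-reflexive (sym (length-++ l₂))))) e
          step {x} {y} (inj₁ x∈B) ¬sy y∉ e | yes _ | ys , zs , req , l4 = jump ys req l4 hd
            where
            jump : ∀ ys → rest ≡ ys ++ y ∷ zs → 4 ≤ length ys →
                   ¬ (rest ≡ [] ⊎ ∃₂ λ w r → rest ≡ w ∷ r × ToLost w)
            jump (_ ∷ _) req _ (inj₁ none) with trans (sym none) req
            ... | ()
            -- As `B` is closed and `a` is outside it, `x` has no arc to `a`, so the tournament has
            -- one from `a` to `x`. Then `w`, `a`, `x`, `y` bypasses the path vertices between `w`
            -- and `y`. There must be at least three of these, so `F` consists of `w` and three
            -- more.
            jump (_ ∷ ys) req (s≤s l3) (inj₂ (w , r , weq , a , (a∉B , a∉Z) , wa)) =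
              no-detour pre {m = ys} (trans eq (cong (pre ++_) req)) l3
                (a∉Z ∘ ∈-++⁺ʳ S ∘ ∈-++⁺ʳ vs) (B∌ x∈B ∘ ∈-++⁺ʳ S ∘ ∈-++⁺ʳ vs)
                (subst (λ z → E z a) (proj₁ (∷-injective (trans (sym weq) req))) wa)
                (flipped (λ { refl → a∉B x∈B }) (λ xa → a∉B (closed x∈B a∉Z xa))) e
          final : ⊥
          final with Good.reach good (S ++ F) (fits S F (length-take-≤ 4 rest) l) {v} (λ i → v∉ (assoc S F F⊆ i))
          ... | o , q , oo , w , av with crossing side? w (start-side oo (av (head∈ w))) ¬side
          ...   | x , y , _ , y∈ , e , sx , ¬sy = step sx ¬sy (av y∈) e

-- Linking many pairs

linkage-reverse : ∀ {N n} {E : Fin N → Fin N → Set} {X} {O I : Fin n → Fin N → Set} →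
                  Linkage E X O I → Linkage (flip E) X I O
linkage-reverse L = record
  { vs = reverse ∘ vs ; src = tgt ; tgt = src ; walk = walk-reverse ∘ walk ; src∈ = tgt∈ ; tgt∈ = src∈
  ; vs! = λ j → Unique-↭ (↭-sym (↭-reverse (vs j))) (vs! j)
  ; disjoint = λ p q → disjoint (AnyP.reverse⁻ p) (AnyP.reverse⁻ q)
  ; avoid = avoid ∘ AnyP.reverse⁻
  ; cover = λ v∉ → let j , i = cover v∉ in j , AnyP.reverse⁺ i }
  where open Linkage L

linkage-mono : ∀ {N n} {E : Fin N → Fin N → Set} {X} {O O′ I I′ : Fin n → Fin N → Set} →
               (∀ j {v} → O j v → O′ j v) → (∀ j {v} → I j v → I′ j v) → Linkage E X O I → Linkage E X O′ I′
linkage-mono f g L = record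
  { vs = vs ; src = src ; tgt = tgt ; walk = walk ; src∈ = λ j → f j (src∈ j) ; tgt∈ = λ j → g j (tgt∈ j)
  ; vs! = vs! ; disjoint = disjoint ; avoid = avoid ; cover = cover }
  where open Linkage L

-- `u` dominates every admissible first vertex, so it can be put in front of whichever `j`-th path
-- the smaller problem returns.
reserve : ∀ {N n} {E : Fin N → Fin N → Set} {X u} {O O′ I : Fin n → Fin N → Set} (j : Fin n) →
          u ∉ X → O j u → (∀ {v} → v ∉ u ∷ X → O′ j v → E u v) → (∀ {i v} → i ≢ j → O′ i v → O i v) →
          Linkage E (u ∷ X) O′ I → Linkage E X O I
reserve {N} {n} {E} {X} {u} {O} {O′} {I} j u∉ ou dom keep L = record
  { vs = λ i → Row.p (row i) ; src = λ i → Row.s (row i) ; tgt = λ i → Row.t (row i) ; walk = λ i → Row.w (row i)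
  ; src∈ = λ i → Row.o (row i) ; tgt∈ = λ i → Row.ii (row i) ; vs! = λ i → Row.u! (row i)
  ; disjoint = λ {i} {k} → disj {i} {k} ; avoid = λ {i} → av {i} ; cover = cov }
  where
  open Linkage L
  record Row (i : Fin n) : Set where
    field
      {s t} : Fin N
      {p}   : List (Fin N)
      w     : Walk E s t p
      o     : O i s
      ii    : I i t
      u!    : Unique p
      from  : ∀ {v} → v ∈ p → v ∈ vs i ⊎ (v ≡ u × i ≡ j)
      to    : ∀ {v} → v ∈ vs i → v ∈ p
      own   : i ≡ j → u ∈ p
  row : ∀ i → Row i
  row i with i ≟ j
  ... | no i≢j = record { w = walk i ; o = keep i≢j (src∈ i) ; ii = tgt∈ i ; u! = vs! i ; from = inj₁ ; to = id
                        ; own = ⊥-elim ∘ i≢j }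
  ... | yes refl = record
    { w = dom (avoid (head∈ (walk j))) (src∈ j) ▸ walk j ; o = ou ; ii = tgt∈ j
    ; u! = All.tabulate (λ { v∈ refl → avoid v∈ (here refl) }) ∷ vs! j
    ; from = λ { (here refl) → inj₂ (refl , refl) ; (there k) → inj₁ k } ; to = there ; own = λ _ → here refl }
  disj : ∀ {i k v} → v ∈ Row.p (row i) → v ∈ Row.p (row k) → i ≡ k
  disj {i} {k} p q with Row.from (row i) p | Row.from (row k) q
  ... | inj₁ a          | inj₁ b          = disjoint a b
  ... | inj₁ a          | inj₂ (refl , _) = ⊥-elim (avoid a (here refl))
  ... | inj₂ (refl , _) | inj₁ b          = ⊥-elim (avoid b (here refl))
  ... | inj₂ (_ , refl) | inj₂ (_ , refl) = refl
  av : ∀ {i v} → v ∈ Row.p (row i) → v ∉ X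
  av {i} p with Row.from (row i) p
  ... | inj₁ a          = avoid a ∘ there
  ... | inj₂ (refl , _) = u∉
  cov : ∀ {v} → v ∉ X → ∃ λ i → v ∈ Row.p (row i)
  cov {v} v∉ with v ≟ u
  ... | yes refl = j , Row.own (row j) refl
  ... | no v≢u with cover {v} (λ { (here eq) → v≢u eq ; (there k) → v∉ k })
  ...   | i , k = i , Row.to (row i) k

record DecSet (N : ℕ) : Set₁ where
  field
    holds : Fin N → Set
    dec   : ∀ v → Dec (holds v)
open DecSet

module _ {N n : ℕ} {E : Fin N → Fin N → Set} {X : List (Fin N)} where

  add-path : {O₀ I₀ : DecSet N} {Os Is : Fin n → DecSet N} → ∀ {s t p} → Walk E s t p → Unique p → holds O₀ s →
      holds I₀ t →
             (∀ {v} → v ∈ p → v ∉ X) → Linkage E (p ++ X) (holds ∘ Os) (holds ∘ Is) →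
             Linkage E X (holds ∘ (O₀ VF.∷ Os)) (holds ∘ (I₀ VF.∷ Is))
  add-path {s = s} {t} {p} w p! os it av L = record
    { vs = p VF.∷ vs ; src = s VF.∷ src ; tgt = t VF.∷ tgt
    ; walk = λ { zero → w ; (suc j) → walk j } ; src∈ = λ { zero → os ; (suc j) → src∈ j }
    ; tgt∈ = λ { zero → it ; (suc j) → tgt∈ j } ; vs! = λ { zero → p! ; (suc j) → vs! j }
    ; disjoint = λ {i} {j} → disj i j ; avoid = λ {j} → avo j ; cover = cov }
    where
    open Linkage L
    disj : ∀ i j {v} → v ∈ (p VF.∷ vs) i → v ∈ (p VF.∷ vs) j → i ≡ j
    disj zero    zero    _ _ = refl
    disj zero    (suc j) a b = ⊥-elim (avoid b (∈-++⁺ˡ a))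
    disj (suc i) zero    a b = ⊥-elim (avoid a (∈-++⁺ˡ b))
    disj (suc i) (suc j) a b = cong suc (disjoint a b)
    avo : ∀ j {v} → v ∈ (p VF.∷ vs) j → v ∉ X
    avo zero    a = av a
    avo (suc j) a = avoid a ∘ ∈-++⁺ʳ p
    open import Data.List.Membership.DecPropositional (_≟_ {N}) using (_∈?_)
    cov : ∀ {v} → v ∉ X → ∃ λ j → v ∈ (p VF.∷ vs) j
    cov {v} v∉ with v ∈? p
    ... | yes i = zero , i
    ... | no v∉p with cover {v} (λ i → case (∈-++⁻ p i))
      where
      case : ¬ (v ∈ p ⊎ v ∈ X)
      case (inj₁ k) = v∉p k
      case (inj₂ k) = v∉ k
    ...   | j , k = suc j , k

shortest-simple : ∀ {N} {E : Fin N → Fin N → Set} {X O I} → Shortest E X O I →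
                  Σ[ P ∈ Shortest E X O I ] Unique (Shortest.vs P)
shortest-simple P with walk-simple _≟_ (Shortest.walk P)
... | q , w , q! , q⊆ =
  record { walk = w ; src∈ = src∈ ; tgt∈ = tgt∈ ; avoid = avoid ∘ q⊆
         ; minimal = λ w′ o i av → ≤-trans (Unique⇒length≤ q! q⊆) (minimal w′ o i av) } , q!
  where open Shortest P

bound : ℕ → ℕ
bound n = n * n + n + 1

-- Induction on the number of pairs.

module Main {N : ℕ} (E : Fin N → Fin N → Set)
  (total : ∀ {x y} → x ≢ y → E x y ⊎ E y x) (asym : ∀ {x y} → E x y → ¬ E y x) where

  private
    totalᵒ : ∀ {x y} → x ≢ y → E y x ⊎ E x y
    totalᵒ ne = total (ne ∘ sym)
    asymᵒ : ∀ {x y} → E y x → ¬ E x y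
    asymᵒ e e′ = asym e e′

  module Fw = Tournament E total asym
  module Bw = Tournament (flip E) totalᵒ asymᵒ
  open import Data.List.Membership.DecPropositional (_≟_ {N}) using (_∈?_)

  -- Jx, Jy hold the indices whose sets may still differ from those of the base pair.
  record State (n h : ℕ) (X : List (Fin N)) (O₀ I₀ : DecSet N) (Os Is : Fin n → DecSet N)
      (Jx Jy : List (Fin n)) : Set₁ where
    field
      good₀   : Good E h X (holds O₀)
      cogood₀ : Good (flip E) h X (holds I₀)
      good    : ∀ j → Good E h X (holds (Os j))
      cogood  : ∀ j → Good (flip E) h X (holds (Is j))
      same-O  : ∀ j → j ∈ Jx ⊎ Os j ≡ O₀
      same-I  : ∀ j → j ∈ Jy ⊎ Is j ≡ I₀

  Result : ∀ {n} (X : List (Fin N)) (O₀ I₀ : DecSet N) (Os Is : Fin n → DecSet N) → Set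
  Result X O₀ I₀ Os Is = Linkage E X (holds ∘ (O₀ VF.∷ Os)) (holds ∘ (I₀ VF.∷ Is))

  module _ {n : ℕ} where

    parallel-O : ∀ {h X O₀ I₀ Jy} {Os Is : Fin n → DecSet N} → State n h X O₀ I₀ Os Is [] Jy →
                 suc n * 3 ≤ h → Result X O₀ I₀ Os Is
    parallel-O {O₀ = O₀} {I₀} {Os = Os} {Is} st le = linkage-mono same (λ _ i → i)
      (Tournament.Common.parallel E total asym (holds O₀) (holds ∘ (I₀ VF.∷ Is)) _ (dec O₀)
          (λ j → dec ((I₀ VF.∷ Is) j)) zero
        (good-weaken le good₀) (λ { zero → good-weaken le cogood₀ ; (suc j) → good-weaken le (cogood j) }))
      where
      open State st
      same : ∀ j {v} → holds O₀ v → holds ((O₀ VF.∷ Os) j) v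
      same zero    o = o
      same (suc j) o with same-O j
      ... | inj₂ eq = subst (λ S → holds S _) (sym eq) o

    parallel-I : ∀ {h X O₀ I₀ Jx} {Os Is : Fin n → DecSet N} → State n h X O₀ I₀ Os Is Jx [] →
                 suc n * 3 ≤ h → Result X O₀ I₀ Os Is
    parallel-I {O₀ = O₀} {I₀} {Os = Os} {Is} st le = linkage-mono (λ _ o → o) same (linkage-reverse
      (Tournament.Common.parallel (flip E) totalᵒ asymᵒ (holds I₀) (holds ∘ (O₀ VF.∷ Os)) _ (dec I₀)
          (λ j → dec ((O₀ VF.∷ Os) j)) zero
        (good-weaken le cogood₀) (λ { zero → good-weaken le good₀ ; (suc j) → good-weaken le (good j) })))
      where
      open State st
      same : ∀ j {v} → holds I₀ v → holds ((I₀ VF.∷ Is) j) v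
      same zero    i = i
      same (suc j) i with same-I j
      ... | inj₂ eq = subst (λ S → holds S _) (sym eq) i

    private
      updated : {Os : Fin n → DecSet N} {S : DecSet N} (j : Fin n) (P : Fin n → DecSet N → Set) →
                P j S → (∀ i → i ≢ j → P i (Os i)) → ∀ i → P i (VF.updateAt Os j (const S) i)
      updated {Os} j P pj pi i with i ≟ j
      ... | yes refl = subst (P j) (sym (updateAt-updates j Os)) pj
      ... | no i≢j   = subst (P i) (sym (updateAt-minimal i j Os i≢j)) (pi i i≢j)

      shrink : ∀ {j i : Fin n} {J J′} {A : Set₁} → J ↭ j ∷ J′ → i ≢ j → i ∈ J ⊎ A → i ∈ J′ ⊎ A
      shrink e i≢j (inj₂ a) = inj₂ a
      shrink e i≢j (inj₁ i∈) with ∈-resp-↭ e i∈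
      ... | here eq = ⊥-elim (i≢j eq)
      ... | there k = inj₁ k

    reserve-O : ∀ {h X O₀ I₀ Jx Jx′ Jy u} {Os Is : Fin n → DecSet N} (j : Fin n) → State n (suc h) X O₀ I₀ Os Is Jx Jy →
                Jx ↭ j ∷ Jx′ → State n h (u ∷ X) O₀ I₀ (VF.updateAt Os j (const O₀)) Is Jx′ Jy
    reserve-O {O₀ = O₀} {u = u} {Os} {Is} j st e = record
      { good₀ = good-remove u ≤-refl good₀ ; cogood₀ = good-remove u ≤-refl cogood₀
      ; good = updated j (λ _ S → Good E _ (u ∷ _) (holds S)) (good-remove u ≤-refl good₀)
          (λ i _ → good-remove u ≤-refl (good i))
      ; cogood = λ i → good-remove u ≤-refl (cogood i)
      ; same-O = same
      ; same-I = same-I }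
      where
      open State st
      same : ∀ i → i ∈ _ ⊎ VF.updateAt Os j (const O₀) i ≡ O₀
      same i with i ≟ j
      ... | yes refl = inj₂ (updateAt-updates j Os)
      ... | no i≢j = shrink e i≢j (subst (λ S → i ∈ _ ⊎ S ≡ O₀) (sym (updateAt-minimal i j Os i≢j)) (same-O i))

    reserve-I : ∀ {h X O₀ I₀ Jx Jy Jy′ u} {Os Is : Fin n → DecSet N} (j : Fin n) → State n (suc h) X O₀ I₀ Os Is Jx Jy →
                Jy ↭ j ∷ Jy′ → State n h (u ∷ X) O₀ I₀ Os (VF.updateAt Is j (const I₀)) Jx Jy′
    reserve-I {I₀ = I₀} {u = u} {Os} {Is} j st e = record
      { good₀ = good-remove u ≤-refl good₀ ; cogood₀ = good-remove u ≤-refl cogood₀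
      ; cogood = updated j (λ _ S → Good (flip E) _ (u ∷ _) (holds S)) (good-remove u ≤-refl cogood₀)
          (λ i _ → good-remove u ≤-refl (cogood i))
      ; good = λ i → good-remove u ≤-refl (good i)
      ; same-I = same
      ; same-O = same-O }
      where
      open State st
      same : ∀ i → i ∈ _ ⊎ VF.updateAt Is j (const I₀) i ≡ I₀
      same i with i ≟ j
      ... | yes refl = inj₂ (updateAt-updates j Is)
      ... | no i≢j = shrink e i≢j (subst (λ S → i ∈ _ ⊎ S ≡ I₀) (sym (updateAt-minimal i j Is i≢j)) (same-I i))

    -- Being far from `O₀` excludes arcs to `u` from vertices of `O₀` outside `X`; in a tournament
    -- `u` then dominates all of these other than itself. The relation `F` is arbitrary so that both
    -- directions are served.
    unreserve : ∀ {F : Fin N → Fin N → Set} {X u} {O₀ : DecSet N} {Os : Fin n → DecSet N}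
        {I : Fin (suc n) → Fin N → Set} (j : Fin n) →
                (∀ {x y} → x ≢ y → ¬ F x y → F y x) → u ∉ X → holds (Os j) u → ¬ Near F X (holds O₀) u →
                Linkage F (u ∷ X) (holds ∘ (O₀ VF.∷ VF.updateAt Os j (const O₀))) I →
                Linkage F X (holds ∘ (O₀ VF.∷ Os)) I
    unreserve {F} {X} {u} {O₀} {Os} j flp u∉ ou far = reserve (suc j) u∉ ou dom keep
      where
      dom : ∀ {v} → v ∉ u ∷ X → holds (VF.updateAt Os j (const O₀) j) v → F u v
      dom {v} v∉ o = flp (λ { refl → v∉ (here refl) })
        (λ e → far (inj₂ (inj₁ (v , (subst (λ S → holds S v) (updateAt-updates j Os) o , v∉ ∘ there) , e))))
      keep : ∀ {i v} → i ≢ suc j → holds ((O₀ VF.∷ VF.updateAt Os j (const O₀)) i) v → holds ((O₀ VF.∷ Os) i) v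
      keep {zero}  _ o = o
      keep {suc i} ne o = subst (λ S → holds S _) (updateAt-minimal i j Os (ne ∘ cong suc)) o

  private
    -- Both lists are nonempty and contribute the `+ 2` of the identity. For `a` and `b` zero there
    -- is no slack: the four of `geodesic-good` is exactly what `bound` provides.
    arith-near : ∀ n {h a b} → bound (suc (suc n)) + (suc a + suc b) ≤ h + 2 * suc n → 4 + bound (suc n) ≤ h
    arith-near n {h} {a} {b} le = +-cancelʳ-≤ (2 * suc n) _ _ (≤-trans (≤-trans (≤-reflexive (eq n))
        (+-monoʳ-≤ (bound (suc (suc n))) (s≤s (≤-trans (s≤s z≤n) (m≤n+m (suc b) a))))) le)
      where
      eq : ∀ n → 4 + ((suc n) * (suc n) + suc n + 1) + 2 * suc n ≡ ((suc (suc n)) * (suc (suc n)) + suc (suc n) + 1) + 2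
      eq = solve-∀

    -- At `n ≡ 1` the left side of `go` is 8 while `bound 2` is 7, so one remaining index has to
    -- make up the difference. This is why `process` carries the alternative `n ≡ 0 ⊎ 1 ≤ c`.
    arith-parallel : ∀ n {h c} → n ≡ 0 ⊎ 1 ≤ c → bound (suc n) + c ≤ h + 2 * n → suc n * 3 ≤ h
    arith-parallel n {h} {c} nc le = +-cancelʳ-≤ (2 * n) _ _ (≤-trans (go n nc) le)
      where
      go : ∀ n → n ≡ 0 ⊎ 1 ≤ c → suc n * 3 + 2 * n ≤ bound (suc n) + c
      go zero          _        = m≤m+n 3 c
      go (suc zero)    (inj₂ l) = +-monoʳ-≤ 7 l
      go (suc (suc n)) _        = ≤-trans (m≤m+n _ (n * n + 2 * n)) (≤-trans (≤-reflexive (eq n)) (m≤m+n _ c))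
        where
        eq : ∀ n → suc (suc (suc n)) * 3 + 2 * suc (suc n) + (n * n + 2 * n)
            ≡ suc (suc (suc n)) * suc (suc (suc n)) + suc (suc (suc n)) + 1
        eq = solve-∀

    arith-pos : ∀ n {c} → ¬ (bound (suc n) + c ≤ 2 * n)
    arith-pos n {c} le = n≮n (2 * n)
        (≤-trans (≤-trans (m≤m+n _ (n * n + n + 2)) (≤-reflexive (eq n))) (≤-trans (m≤m+n _ c) le))
      where
      eq : ∀ n → suc (2 * n) + (n * n + n + 2) ≡ suc n * suc n + suc n + 1
      eq = solve-∀

    arith-step : ∀ n {h a b c} → a ≡ suc b → bound n + (a + c) ≤ suc h + 2 * pred n → bound n + (b + c) ≤ h + 2 * pred n
    arith-step n {b = b} {c} refl le = ≤-pred (≤-trans (≤-reflexive (sym (+-suc (bound n) (b + c)))) le)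

  Far : (Fin N → Fin N → Set) → ∀ {n} → List (Fin N) → DecSet N → (Fin n → DecSet N) → Set
  Far F X S Ss = ∃ λ j → ∃ λ u → holds (Ss j) u × u ∉ X × ¬ Near F X (holds S) u

  Linkable : ℕ → Set₁
  Linkable n = ∀ {h X} {O₀ I₀ : DecSet N} {Os Is : Fin n → DecSet N} →
    Good E h X (holds O₀) → Good (flip E) h X (holds I₀) →
    (∀ j → Good E h X (holds (Os j))) → (∀ j → Good (flip E) h X (holds (Is j))) →
    bound (suc n) ≤ h → Result X O₀ I₀ Os Is

  -- A reservation lowers `h` and the total length of the lists by one each, which preserves the
  -- last inequality, and `f` bounds the number of reservations. The processing stops as soon as one
  -- list is empty, so the other list keeps the total positive. `IH` is an argument so that the
  -- recursion on the number of pairs stays structural in `linked`.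
  process : ∀ n (IH : ∀ m → suc m ≡ n → Linkable m) f {h X} {O₀ I₀ : DecSet N} {Os Is : Fin n → DecSet N} Jx Jy →
            length Jx + length Jy ≤ f → State n h X O₀ I₀ Os Is Jx Jy → n ≡ 0 ⊎ 1 ≤ length Jx + length Jy →
            bound (suc n) + (length Jx + length Jy) ≤ h + 2 * n → Result X O₀ I₀ Os Is
  process n IH f []       Jy       _ st nc le = parallel-O st (arith-parallel n nc le)
  process n IH f (j ∷ Jx) []       _ st nc le = parallel-I st (arith-parallel n nc le)
  process (suc n) IH zero    (i ∷ Jx) (j ∷ Jy) ()
  process (suc n) IH (suc f) {zero} (i ∷ Jx) (j ∷ Jy) _ st nc le = ⊥-elim (arith-pos (suc n) le)
  process (suc n) IH (suc f) {suc h} {X} {O₀} {I₀} {Os} {Is} (i ∷ Jx) (j ∷ Jy) lf st nc le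
    with any? (λ k → any? (λ u → dec (Os k) u ×-dec ¬? (u ∈? X) ×-dec ¬? (Fw.near? X (dec O₀) u)))
       | any? (λ k → any? (λ u → dec (Is k) u ×-dec ¬? (u ∈? X) ×-dec ¬? (Bw.near? X (dec I₀) u)))
  ... | yes (k , u , ou , u∉ , far) | _ with State.same-O st k
  ...   | inj₂ eq = ⊥-elim (far (inj₁ (subst (λ S → holds S u) eq ou)))
  ...   | inj₁ k∈ with ∈⇒↭ k∈
  ...     | J′ , e =
    unreserve k Fw.flipped u∉ ou far
      (process (suc n) IH f J′ (j ∷ Jy)
          (≤-pred (≤-trans (≤-reflexive (cong (_+ suc (length Jy)) (sym (↭-length e)))) lf))
        (reserve-O k st e) (inj₂ (≤-trans (s≤s z≤n) (m≤n+m (suc (length Jy)) (length J′))))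
        (arith-step (suc (suc n)) (↭-length e) le))
  process (suc n) IH (suc f) {suc h} {X} {O₀} {I₀} {Os} {Is} (i ∷ Jx) (j ∷ Jy) lf st nc le
    | no _ | yes (k , u , iu , u∉ , far) with State.same-I st k
  ...   | inj₂ eq = ⊥-elim (far (inj₁ (subst (λ S → holds S u) eq iu)))
  ...   | inj₁ k∈ with ∈⇒↭ k∈
  ...     | J′ , e =
    linkage-reverse (unreserve k (λ ne ¬e → Fw.flipped (ne ∘ sym) ¬e) u∉ iu far (linkage-reverse
      (process (suc n) IH f (i ∷ Jx) J′
        (≤-pred (≤-trans (≤-reflexive (trans (sym (+-suc (suc (length Jx)) (length J′)))
            (cong (suc (length Jx) +_) (sym (↭-length e))))) lf))
        (reserve-I k st e) (inj₂ (s≤s z≤n))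
        (≤-trans (≤-reflexive (cong (bound (suc (suc n)) +_) (+-comm (suc (length Jx)) (length J′))))
          (arith-step (suc (suc n)) (↭-length e)
            (≤-trans (≤-reflexive (cong (bound (suc (suc n)) +_) (+-comm (suc (length Jy)) (suc (length Jx))))) le))))))
  process (suc n) IH (suc f) {suc h} {X} {O₀} {I₀} {Os} {Is} (i ∷ Jx) (j ∷ Jy) lf st nc le
    | no ¬farO | no ¬farI = detach
    where
    open State st
    h≥ : 4 + bound (suc n) ≤ suc h
    h≥ = arith-near n {suc h} {length Jx} {length Jy} le
    near : (F : Fin N → Fin N → Set) (S : DecSet N) (Ss : Fin (suc n) → DecSet N) → (∀ u → Dec (Near F X (holds S) u)) →
           ¬ Far F X S Ss → ∀ k {u} → holds (Ss k) u → u ∉ X → Near F X (holds S) u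
    near F S Ss near? ¬far k {u} ou u∉ with near? u
    ... | yes nr = nr
    ... | no ¬nr = ⊥-elim (¬far (k , u , ou , u∉ , ¬nr))
    detach : Result X O₀ I₀ Os Is
    detach with Good.some cogood₀ [] (s≤s z≤n)
    ... | t , it , t∉ with Good.reach good₀ [] (s≤s z≤n) t∉
    ... | s , p , os , w , av with shortest-simple (Fw.shortest X (dec O₀) (dec I₀) w os it av)
    ... | P , P! = add-path {O₀ = O₀} {I₀} {Os} {Is} (Shortest.walk P) P! (Shortest.src∈ P) (Shortest.tgt∈ P)
        (Shortest.avoid P)
          -- The pair with index `zero` becomes the new base pair, and the lists are filled afresh.
          (linkage-mono shape-O shape-I (IH n refl (g zero) (c zero) (g ∘ suc) (c ∘ suc) ≤-refl))
      where
      vs = Shortest.vs P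
      g : ∀ k → Good E (bound (suc n)) (vs ++ X) (holds (Os k))
      g k = Fw.geodesic-good P (dec (Os k)) h≥ (good k) (near E O₀ Os (Fw.near? X (dec O₀)) ¬farO k)
      rev⊆ : reverse vs ++ X ⊆ vs ++ X
      rev⊆ x∈ with ∈-++⁻ (reverse vs) x∈
      ... | inj₁ y = ∈-++⁺ˡ {xs = vs} (AnyP.reverse⁻ y)
      ... | inj₂ y = ∈-++⁺ʳ vs y
      ⊆rev : vs ++ X ⊆ reverse vs ++ X
      ⊆rev x∈ with ∈-++⁻ vs x∈
      ... | inj₁ y = ∈-++⁺ˡ (AnyP.reverse⁺ y)
      ... | inj₂ y = ∈-++⁺ʳ (reverse vs) y
      c : ∀ k → Good (flip E) (bound (suc n)) (vs ++ X) (holds (Is k))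
      c k = good-resp rev⊆ ⊆rev (Bw.geodesic-good (shortest-reverse P) (dec (Is k)) h≥ (cogood k)
              (near (flip E) I₀ Is (Bw.near? X (dec I₀)) ¬farI k))
      shape-O : ∀ k {v} → holds ((Os zero VF.∷ Os ∘ suc) k) v → holds (Os k) v
      shape-O zero    o = o
      shape-O (suc k) o = o
      shape-I : ∀ k {v} → holds ((Is zero VF.∷ Is ∘ suc) k) v → holds (Is k) v
      shape-I zero    o = o
      shape-I (suc k) o = o

  linked : ∀ n → Linkable n
  linked n g₀ c₀ g c le = process n (smaller n) _ (allFin n) (allFin n) ≤-refl
    (record { good₀ = g₀ ; cogood₀ = c₀ ; good = g ; cogood = c
            ; same-O = λ j → inj₁ (∈-allFin j) ; same-I = λ j → inj₁ (∈-allFin j) })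
    (positive n) (+-mono-≤ le (≤-reflexive lens))
    where
    smaller : ∀ n m → suc m ≡ n → Linkable m
    smaller (suc n) .n refl = linked n
    positive : ∀ n → n ≡ 0 ⊎ 1 ≤ length (allFin n) + length (allFin n)
    positive zero    = inj₁ refl
    positive (suc n) = inj₂ (s≤s z≤n)
    lens : length (allFin n) + length (allFin n) ≡ 2 * n
    lens = trans (cong₂ _+_ (length-tabulate {n = n} id) (length-tabulate {n = n} id))
        (cong (n +_) (sym (+-identityʳ n)))

-- Strongly connected digraphs

fromList : ∀ {N} → List (Fin N) → Subset N
fromList = foldr (λ v S → ⁅ v ⁆ ∪ₛ S) ∅

∣p∪q∣≤∣p∣+∣q∣ : ∀ {N} (p q : Subset N) → ∣ p ∪ₛ q ∣ ≤ ∣ p ∣ + ∣ q ∣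
∣p∪q∣≤∣p∣+∣q∣ Vec.[]            Vec.[]            = z≤n
∣p∪q∣≤∣p∣+∣q∣ (outside Vec.∷ p) (outside Vec.∷ q) = ∣p∪q∣≤∣p∣+∣q∣ p q
∣p∪q∣≤∣p∣+∣q∣ (outside Vec.∷ p) (inside  Vec.∷ q) = ≤-trans (s≤s (∣p∪q∣≤∣p∣+∣q∣ p q))
    (≤-reflexive (sym (+-suc ∣ p ∣ ∣ q ∣)))
∣p∪q∣≤∣p∣+∣q∣ (inside  Vec.∷ p) (outside Vec.∷ q) = s≤s (∣p∪q∣≤∣p∣+∣q∣ p q)
∣p∪q∣≤∣p∣+∣q∣ (inside  Vec.∷ p) (inside  Vec.∷ q) = s≤s (≤-trans (∣p∪q∣≤∣p∣+∣q∣ p q) (+-monoʳ-≤ ∣ p ∣ (n≤1+n ∣ q ∣)))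

∣fromList∣ : ∀ {N} (F : List (Fin N)) → ∣ fromList F ∣ ≤ length F
∣fromList∣ {N} []      = ≤-reflexive (∣⊥∣≡0 N)
∣fromList∣     (v ∷ F) = ≤-trans (∣p∪q∣≤∣p∣+∣q∣ ⁅ v ⁆ (fromList F)) (+-mono-≤ (≤-reflexive (∣⁅x⁆∣≡1 v)) (∣fromList∣ F))

∈-fromList⁻ : ∀ {N} {F : List (Fin N)} {v} → v ∈ₛ fromList F → v ∈ F
∈-fromList⁻ {F = []}    i = ⊥-elim (∉⊥ i)
∈-fromList⁻ {F = u ∷ F} i with x∈p∪q⁻ ⁅ u ⁆ (fromList F) i
... | inj₁ j = here (x∈⁅y⁆⇒x≡y u j)
... | inj₂ j = there (∈-fromList⁻ j)

∈-fromList⁺ : ∀ {N} {F : List (Fin N)} {v} → v ∈ F → v ∈ₛ fromList F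
∈-fromList⁺ {F = u ∷ F} (here refl) = p⊆p∪q (fromList F) (x∈⁅x⁆ u)
∈-fromList⁺ {F = u ∷ F} (there i)   = q⊆p∪q ⁅ u ⁆ (fromList F) (∈-fromList⁺ i)

Robust : ∀ {N} → (Fin N → Fin N → Set) → ℕ → Set
Robust R c = ∀ F → length F < c → ∀ {a b} → a ∉ F → b ∉ F →
             ∃ λ p → Walk R a b p × Unique p × (∀ {u} → u ∈ p → u ∉ F)

robust-reverse : ∀ {N} {R : Fin N → Fin N → Set} {c} → Robust R c → Robust (flip R) c
robust-reverse rob F l a∉ b∉ with rob F l b∉ a∉
... | p , w , p! , av = reverse p , walk-reverse w , Unique-↭ (↭-sym (↭-reverse p)) p! , av ∘ AnyP.reverse⁻

module _ {N : ℕ} {R : Fin N → Fin N → Set} {c h : ℕ} (rob : Robust R c) (c<N : c < N)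
  {X : List (Fin N)} (size : h + length X ≤ suc c) {r : Fin N} (r∈X : r ∈ X) where

  open import Data.List.Membership.DecPropositional (_≟_ {N}) using (_∈?_)

  private
    total≤ : ∀ S → length S < h → length (S ++ X) ≤ c
    total≤ S l = ≤-pred (≤-trans (≤-trans (s≤s (≤-reflexive (length-++ S))) (+-monoˡ-≤ (length X) l)) size)

    reach : ∀ S → length S < h → ∀ {v} → v ∉ S ++ X →
            ∃₂ λ o p → R r o × Walk R o v p × (∀ {u} → u ∈ p → u ∉ S ++ X)
    reach S l {v} v∉ = tail-of (rob F F<c r∉F (λ i → v∉ (proj₁ (∈-filter⁻ other? {xs = S ++ X} i))))
      where
      other? = λ u → ¬? (u ≟ r)
      -- The walk must start at `r`, so `r` alone is spared; this accounts for the `suc` in `size`.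
      -- The path is simple and never returns to `r`, so its tail avoids all of `S ++ X`.
      F = filter other? (S ++ X)
      F<c : length F < c
      F<c = <-≤-trans (filter-notAll other? (S ++ X) (lose (∈-++⁺ʳ S r∈X) (λ n → n refl))) (total≤ S l)
      r∉F : r ∉ F
      r∉F i = proj₂ (∈-filter⁻ other? {xs = S ++ X} i) refl
      tail-of : (∃ λ p → Walk R r v p × Unique p × (∀ {u} → u ∈ p → u ∉ F)) →
                ∃₂ λ o p → R r o × Walk R o v p × (∀ {u} → u ∈ p → u ∉ S ++ X)
      tail-of (_ , stop _ , _ , _) = ⊥-elim (v∉ (∈-++⁺ʳ S r∈X))
      tail-of (_ , e ▸ w , n ∷ _ , av) = _ , _ , e , w ,
        λ i j → av (there i) (∈-filter⁺ other? j (λ { refl → lookup n i refl }))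

  robust⇒good : Good R h X (R r)
  robust⇒good = record { some = some ; reach = reach }
    where
    some : ∀ S → length S < h → ∃ λ o → R r o × o ∉ S ++ X
    some S l with all? (_∈? (S ++ X)) (allFin N)
    ... | yes al = ⊥-elim (n≮n _ (≤-<-trans (≤-trans (≤-reflexive (sym (length-tabulate {n = N} id)))
                     (≤-trans (Unique⇒length≤ (Uniqueₚ.allFin⁺ N) (λ i → lookup al i)) (total≤ S l))) c<N))
    ... | no ¬al with find (¬All⇒Any¬ (_∈? (S ++ X)) _ ¬al)
    ...   | v , _ , v∉ with reach S l v∉
    ...     | o , p , e , w , av = o , e , av (head∈ w)

module _ {G : Digraph} where
  open Digraph G

  linked⇒walk : ∀ {x y} vs → head vs ≡ just x → last vs ≡ just y → Linked _⟶_ vs → Walk _⟶_ x y vs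
  linked⇒walk (v ∷ [])     refl refl _       = stop v
  linked⇒walk (v ∷ u ∷ vs) refl eq   (e ∷ l) = e ▸ linked⇒walk (u ∷ vs) refl eq l

  walk⇒path : ∀ {x y p} → Walk _⟶_ x y p → Unique p → DirectedPath G x y
  walk⇒path {x} {y} {p} w p! = record
    { vertices = p ; starts = hd w ; ends = lst w ; linked = lnk w ; distinct = p! }
    where
    hd : ∀ {x y p} → Walk _⟶_ x y p → head p ≡ just x
    hd (stop x) = refl
    hd (_ ▸ _)  = refl
    lst : ∀ {x y p} → Walk _⟶_ x y p → last p ≡ just y
    lst (stop x)        = refl
    lst (_ ▸ stop x)    = refl
    lst (_ ▸ (e ▸ w))   = lst (e ▸ w)
    lnk : ∀ {x y p} → Walk _⟶_ x y p → Linked _⟶_ p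
    lnk (stop x)        = [-]
    lnk (e ▸ stop x)    = e ∷ [-]
    lnk (e ▸ (e′ ▸ w))  = e ∷ lnk (e′ ▸ w)

  connected⇒robust : ∀ {c} → StronglyConnected c G → Robust _⟶_ c
  connected⇒robust (_ , conn) F l {a} {b} a∉ b∉
    with conn (fromList F) (≤-<-trans (∣fromList∣ F) l) a b (a∉ ∘ ∈-fromList⁻) (b∉ ∘ ∈-fromList⁻)
  ... | P , av = vertices , linked⇒walk vertices starts ends linked , distinct , λ i j → av i (∈-fromList⁺ j)
    where open DirectedPath P

-- From linkages back to directed paths between the terminals.

module Finish {k : ℕ} (T : Digraph) (x y : Fin k → Digraph.Vertex T) (x≢y : ∀ i → x i ≢ y i) where

  open Digraph T
  open import Data.List.Membership.DecPropositional (_≟_ {order}) using (_∈?_)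

  -- Repeated terminals are kept, so the length is `k + k` whatever coincidences occur among them.
  X : List Vertex
  X = tabulate x ++ tabulate y

  x∈ : ∀ j → x j ∈ X
  x∈ j = ∈-++⁺ˡ (∈-tabulate⁺ j)
  y∈ : ∀ j → y j ∈ X
  y∈ j = ∈-++⁺ʳ (tabulate x) (∈-tabulate⁺ j)
  X⁻ : ∀ {v} → v ∈ X → ∃ λ j → v ≡ x j ⊎ v ≡ y j
  X⁻ i with ∈-++⁻ (tabulate x) i
  ... | inj₁ a with ∈-tabulate⁻ a
  ...   | j , eq = j , inj₁ eq
  X⁻ i | inj₂ a with ∈-tabulate⁻ a
  ...   | j , eq = j , inj₂ eq

  module Paths (L : Linkage _⟶_ X (λ j → x j ⟶_) (λ j → _⟶ y j)) where

    open Linkage L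

    path-vertices : Fin k → List Vertex
    path-vertices i = x i ∷ vs i ++ y i ∷ []
    unique : ∀ i → Unique (path-vertices i)
    unique i = All.tabulate fresh ∷ Uniqueₚ.++⁺ (vs! i) ([] ∷ []) (λ { (a , here refl) → avoid a (y∈ i) })
      where
      fresh : ∀ {v} → v ∈ vs i ++ y i ∷ [] → x i ≢ v
      fresh v∈ refl with ∈-++⁻ (vs i) v∈
      ... | inj₁ a         = avoid a (x∈ i)
      ... | inj₂ (here eq) = x≢y i eq
    P : ∀ i → DirectedPath T (x i) (y i)
    P i = walk⇒path {T} (src∈ i ▸ walk-++ (walk i) (tgt∈ i) (stop (y i))) (unique i)
    inner : ∀ i {v} → v ∈ path-vertices i → v ≡ x i ⊎ v ∈ vs i ⊎ v ≡ y i
    inner i (here eq) = inj₁ eq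
    inner i (there v∈) with ∈-++⁻ (vs i) v∈
    ... | inj₁ a         = inj₂ (inj₁ a)
    ... | inj₂ (here eq) = inj₂ (inj₂ eq)
    half : ∀ i j → i ≢ j → ∀ {v} → Interior (P i) v → ¬ V (P j) v
    half i j i≢j (v∈ , ¬end) v∈′ with inner i v∈
    ... | inj₁ refl        = ¬end (inj₁ refl)
    ... | inj₂ (inj₂ refl) = ¬end (inj₂ refl)
    ... | inj₂ (inj₁ a) with inner j v∈′
    ...   | inj₁ refl        = avoid a (x∈ j)
    ...   | inj₂ (inj₂ refl) = avoid a (y∈ j)
    ...   | inj₂ (inj₁ b)    = i≢j (disjoint a b)
    internally : ∀ i j → i ≢ j → InternallyDisjoint (P i) (P j)
    internally i j i≢j = half i j i≢j , half j i (i≢j ∘ sym)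
    terminals : ∀ i → (Terminals x y ∩ V (P i)) ≐ (｛ x i ｝ ∪ ｛ y i ｝)
    terminals i = to , from
      where
      end∈X : ∀ {v} → Terminals x y v → v ∈ X
      end∈X (j , inj₁ refl) = x∈ j
      end∈X (j , inj₂ refl) = y∈ j
      to : ∀ {v} → (Terminals x y ∩ V (P i)) v → (｛ x i ｝ ∪ ｛ y i ｝) v
      to (t , v∈) with inner i v∈
      ... | inj₁ refl        = inj₁ refl
      ... | inj₂ (inj₁ a)    = ⊥-elim (avoid a (end∈X t))
      ... | inj₂ (inj₂ refl) = inj₂ refl
      from : ∀ {v} → (｛ x i ｝ ∪ ｛ y i ｝) v → (Terminals x y ∩ V (P i)) v
      from (inj₁ refl) = (i , inj₁ refl) , here refl
      from (inj₂ refl) = (i , inj₂ refl) , there (∈-++⁺ʳ (vs i) (here refl))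
    covered : ∀ v → ∃ λ i → V (P i) v
    covered v with v ∈? X
    ... | no v∉ with cover v∉
    ...   | i , a = i , there (∈-++⁺ˡ a)
    covered v | yes v∈ with X⁻ v∈
    ...   | j , inj₁ refl = j , here refl
    ...   | j , inj₂ refl = j , there (∈-++⁺ʳ (vs j) (here refl))

theorem1p4 : (k : ℕ) → k ≥ 1 →
    (T : Digraph) → IsTournament T →
    StronglyConnected (k ^ 2 + 3 * k) T →
    (x y : Fin k → Digraph.Vertex T) →
    (∀ i → x i ≢ y i) →
    Injective _≡_ _≡_ (λ i → (x i , y i)) →
    Σ[ P ∈ (∀ i → DirectedPath T (x i) (y i)) ]
    (∀ i j → i ≢ j → InternallyDisjoint (P i) (P j)) ×
    (∀ i → (Terminals x y ∩ V (P i)) ≐ (｛ x i ｝ ∪ ｛ y i ｝)) ×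
    (U ≐ ⋃ (Fin k) (λ i → V (P i)))
theorem1p4 (suc n) _ T tour conn x y x≢y _ = P , internally , terminals , (λ {v} _ → covered v) , λ _ → _
  where
  open Digraph T
  open IsTournament tour
  open Finish T x y x≢y
  k = suc n
  O I : Fin k → DecSet order
  O j = record { holds = x j ⟶_ ; dec = Tournament.E? _⟶_ adjacent asym (x j) }
  I j = record { holds = _⟶ y j ; dec = λ v → Tournament.E? _⟶_ adjacent asym v (y j) }
  size : bound k + length X ≤ suc (k ^ 2 + 3 * k)
  size = ≤-reflexive (trans (cong (bound k +_)
      (trans (length-++ (tabulate x)) (cong₂ _+_ (length-tabulate x) (length-tabulate y)))) (eq k))
    where
    eq : ∀ k → k * k + k + 1 + (k + k) ≡ suc (k * (k * 1) + 3 * k)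
    eq = solve-∀
  rob = connected⇒robust {T} conn
  good : ∀ j → Good _⟶_ (bound k) X (x j ⟶_)
  good j = robust⇒good rob (proj₁ conn) size (x∈ j)
  cogood : ∀ j → Good (flip _⟶_) (bound k) X (_⟶ y j)
  cogood j = robust⇒good (robust-reverse rob) (proj₁ conn) size (y∈ j)
  L : Linkage _⟶_ X (λ j → x j ⟶_) (λ j → _⟶ y j)
  L = linkage-mono (λ { zero e → e ; (suc j) e → e }) (λ { zero e → e ; (suc j) e → e })
    (Main.linked _⟶_ adjacent asym n {O₀ = O zero} {I zero} {O ∘ suc} {I ∘ suc}
      (good zero) (cogood zero) (good ∘ suc) (cogood ∘ suc) ≤-refl)
  open Paths L
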